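{- For every integer $\Delta \geq 29$, $$2^{\frac{\Delta}{2} - 1} \leq \chi_p(\mathcal{G}^{\rm c}_{\Delta}) \leq (\Delta-3) \cdot (\Delta-1) \cdot 2^{\Delta-1} +2.$$
   Context: An oriented graph is a loopless directed graph without opposite arcs (an orientation $\overrightarrow{G}$ of a simple undirected graph $G$). Pushing a vertex $v$ of an oriented graph means reversing the orientation of every arc incident with $v$. Two oriented graphs are in a push relationship if one can be obtained from the other by pushing some set of vertices. For oriented graphs $\overrightarrow{G},\overrightarrow{H}$, a homomorphism is a map $\phi:V(\overrightarrow{G})\to V(\overrightarrow{H})$ such that every arc $uv$ of $\overrightarrow{G}$ is mapped to an arc $\phi(u)\phi(v)$ of $\overrightarrow{H}$. A pushable homomorphism from $\overrightarrow{G}$ to $\overrightarrow{H}$ is a map $\phi$ that is a homomorphism from some oriented graph $\overrightarrow{G}'$ in a push relationship with $\overrightarrow{G}$ to $\overrightarrow{H}$. The pushable chromatic number $\chi_p(\overrightarrow{G})$ is the minimum number of vertices of an oriented graph $\overrightarrow{H}$ such that there is a pushable homomorphism from $\overrightarrow{G}$ to $\overrightarrow{H}$. For an undirected graph $G$, $\chi_p(G)$ is the maximum of $\chi_p(\overrightarrow{G})$ over all orientations $\overrightarrow{G}$ of $G$, and for a family $\mathcal{F}$ of graphs, $\chi_p(\mathcal{F})=\max\{\chi_p(G): G\in\mathcal{F}\}$. $\mathcal{G}^{\rm c}_{\Delta}$ denotes the family of connected graphs with maximum degree $\Delta$. -}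

module Defs where

open import Data.Nat using (ℕ; _+_; _≤_)
open import Data.Fin using (Fin)
open import Data.Bool using (Bool; true; false; if_then_else_; _∨_; _xor_)
open import Data.List using (List; map; allFin)
open import Data.Nat.ListAction using (sum)
open import Data.Product using (Σ; ∃; ∃-syntax; _×_)
open import Relation.Binary.PropositionalEquality using (_≡_)

record Graph (n : ℕ) : Set where
  field
    adj     : Fin n → Fin n → Bool
    sym     : ∀ u v → adj u v ≡ adj v u
    irrefl  : ∀ u → adj u u ≡ false
open Graph public

record OGraph (n : ℕ) : Set where
  field
    arc     : Fin n → Fin n → Bool
    loopless : ∀ u → arc u u ≡ false
    noOpp   : ∀ u v → arc u v ≡ true → arc v u ≡ false
open OGraph public

IsOrientation : ∀ {n} → Graph n → OGraph n → Set
IsOrientation G D = ∀ u v → adj G u v ≡ (arc D u v ∨ arc D v u)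

degree : ∀ {n} → Graph n → Fin n → ℕ
degree {n} G u = sum (map (λ v → if adj G u v then 1 else 0) (allFin n))

MaxDegree : ∀ {n} → Graph n → ℕ → Set
MaxDegree G Δ = (∀ u → degree G u ≤ Δ) × (∃[ u ] degree G u ≡ Δ)

data Walk {n} (G : Graph n) : Fin n → Fin n → Set where
  here : ∀ {u} → Walk G u u
  step : ∀ {u v w} → adj G u v ≡ true → Walk G v w → Walk G u w

Connected : ∀ {n} → Graph n → Set
Connected G = ∀ u v → Walk G u v

-- Arc relation after pushing the set S of vertices (each vertex of S once).
-- An arc uv is reversed iff exactly one of its ends is pushed.
pushArc : ∀ {n} → OGraph n → (Fin n → Bool) → Fin n → Fin n → Bool
pushArc D S u v = if S u xor S v then arc D v u else arc D u v

IsHom : ∀ {n m} → (Fin n → Fin n → Bool) → OGraph m → (Fin n → Fin m) → Set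
IsHom A H φ = ∀ u v → A u v ≡ true → arc H (φ u) (φ v) ≡ true

PushHom : ∀ {n m} → OGraph n → OGraph m → (Fin n → Fin m) → Set
PushHom D H φ = ∃[ S ] IsHom (pushArc D S) H φ

PushColourable : ∀ {n} → OGraph n → ℕ → Set
PushColourable D k =
  ∃[ m ] (m ≤ k × Σ (OGraph m) λ H → ∃[ φ ] PushHom D H φ)

{-# OPTIONS --safe #-}

-- Lower bound: orient the edges of a long band-shaped bipartite graph with N Δ edges and about 2N
-- vertices. A pushable homomorphism to a graph on m vertices, together with the pushed set,
-- determines the orientation, so (2m)^(2N) · O(1) codes would have to produce 2^(NΔ) orientations;
-- if m² < 2^(Δ-2) this is impossible for large N.
--
-- Upper bound: put k = Δ - 1. Counting shows that some tournament on c = k(k-2)2^k vertices, split into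
-- k(k-2) blocks of size 2^k, has the following property: for any k distinct vertices, any prescribed
-- directions to them, and any k blocks, a vertex outside these blocks realises the directions or
-- their opposites. Colour the vertices of G other than a root, each at a moment when it still has an
-- uncoloured neighbour, so that the coloured neighbours of an uncoloured vertex always have distinct
-- colours. A vertex with j coloured neighbours then has j constraints and at most (Δ-j)k forbidden
-- colours, and the property above provides a colour. One extra colour serves the root.
module Submission where

open import Defs renaming (sym to adj-sym)
open import Algebra.Properties.CommutativeSemigroup using (interchange; x∙yz≈y∙xz)
open import Data.Bool using (Bool; true; false; if_then_else_; _∧_; _∨_; _xor_; not)
import Data.Bool.Properties as Bool
open import Data.Empty using (⊥; ⊥-elim)
open import Data.Fin using (Fin; zero; suc; toℕ; fromℕ<; splitAt; join; _↑ˡ_; _↑ʳ_; quotient; remainder; combine; _<?_)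
import Data.Fin.Properties as Fin
open import Data.List as List using (List; []; _∷_; _++_; map; allFin; length; filter; concatMap; cartesianProductWith; cartesianProduct; upTo)
open import Data.List.Membership.Propositional using (_∈_; _∉_; lose)
open import Data.List.Membership.Propositional.Properties using (∈-allFin; ∈-filter⁺; ∈-filter⁻; ∈-lookup; ∈-map⁺; ∈-concatMap⁺; ∈-cartesianProduct⁺; ∈-cartesianProduct⁻; ∈-upTo⁺)
open import Data.List.Properties using (map-++; map-∘; map-cong; map-tabulate; length-tabulate; length-++; length-map; length-filter; length-upTo)
import Data.List.Relation.Unary.All as All
open import Data.List.Relation.Unary.AllPairs using (_∷_)
open import Data.List.Relation.Unary.Any as Any using (here; there)
open import Data.List.Relation.Unary.Any.Properties using (cartesianProductWith⁺; lookup-index)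
open import Data.List.Relation.Unary.Unique.Propositional using (Unique)
open import Data.List.Relation.Unary.Unique.Propositional.Properties using (filter⁺; allFin⁺)
open import Data.Nat using (ℕ; zero; suc; pred; _≤_; _<_; _*_; _∸_; _^_; _+_; z≤n; s≤s; s≤s⁻¹; _≤′_; ≤′-refl; ≤′-step; NonZero; nonZero; >-nonZero; >-nonZero⁻¹; _≤?_)
import Data.Nat as ℕ
open import Data.Nat.ListAction using (sum)
open import Data.Nat.ListAction.Properties using (sum-++)
open import Data.Nat.Properties hiding (_<?_)
open import Data.Nat.Solver using (module +-*-Solver)
open import Data.Product using (Σ; ∃-syntax; _×_; _,_; proj₁; proj₂)
open import Data.Sum using (_⊎_; inj₁; inj₂)
open import Data.Unit using (tt)
open import Data.Vec as Vec using (Vec; []; _∷_; lookup; tabulate)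
open import Data.Vec.Functional using () renaming (_∷_ to _∷ᶠ_)
open import Data.Vec.Properties using (lookup-map; tabulate∘lookup; lookup∘tabulate; tabulate-cong)
open import Function using (_∘_; id)
open import Relation.Binary.Definitions using (tri<; tri≈; tri>)
open import Relation.Binary.PropositionalEquality
open import Relation.Nullary using (Dec; yes; no; does; ¬?)
open import Relation.Nullary.Decidable using (dec-true; dec-false; decidable-stable; _×-dec_; _→-dec_)
open +-*-Solver using (solve; _:+_; _:*_; _:=_; con)

-- Finite sums and enumerations

ind : Bool → ℕ
ind b = if b then 1 else 0

∑ : {A : Set} → List A → (A → ℕ) → ℕ
∑ xs f = sum (map f xs)

∑-mono-∈ : {A : Set} (xs : List A) {f g : A → ℕ} → (∀ x → x ∈ xs → f x ≤ g x) → ∑ xs f ≤ ∑ xs g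
∑-mono-∈ []       p = z≤n
∑-mono-∈ (x ∷ xs) p = +-mono-≤ (p x (here refl)) (∑-mono-∈ xs (λ y y∈ → p y (there y∈)))

∑-mono : {A : Set} (xs : List A) {f g : A → ℕ} → (∀ x → f x ≤ g x) → ∑ xs f ≤ ∑ xs g
∑-mono xs p = ∑-mono-∈ xs (λ x _ → p x)

∑-cong : {A : Set} (xs : List A) {f g : A → ℕ} → (∀ x → f x ≡ g x) → ∑ xs f ≡ ∑ xs g
∑-cong xs p = cong sum (map-cong p xs)

∑-const : {A : Set} (xs : List A) (c : ℕ) → ∑ xs (λ _ → c) ≡ length xs * c
∑-const []       c = refl
∑-const (x ∷ xs) c = cong (c +_) (∑-const xs c)

∑-++ : {A : Set} (xs ys : List A) (f : A → ℕ) → ∑ (xs ++ ys) f ≡ ∑ xs f + ∑ ys f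
∑-++ xs ys f = trans (cong sum (map-++ f xs ys)) (sum-++ (map f xs) (map f ys))

∑-map : {A B : Set} (h : A → B) (xs : List A) (f : B → ℕ) → ∑ (map h xs) f ≡ ∑ xs (f ∘ h)
∑-map h xs f = cong sum (sym (map-∘ xs))

∑-+ : {A : Set} (xs : List A) (f g : A → ℕ) → ∑ xs (λ x → f x + g x) ≡ ∑ xs f + ∑ xs g
∑-+ []       f g = refl
∑-+ (x ∷ xs) f g = trans (cong (f x + g x +_) (∑-+ xs f g)) (interchange +-commutativeSemigroup (f x) (g x) _ _)

∑-*ˡ : {A : Set} (xs : List A) (c : ℕ) (f : A → ℕ) → ∑ xs (λ x → c * f x) ≡ c * ∑ xs f
∑-*ˡ []       c f = sym (*-zeroʳ c)
∑-*ˡ (x ∷ xs) c f = trans (cong (c * f x +_) (∑-*ˡ xs c f)) (sym (*-distribˡ-+ c (f x) _))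

∑-*ʳ : {A : Set} (xs : List A) (f : A → ℕ) (c : ℕ) → ∑ xs (λ x → f x * c) ≡ ∑ xs f * c
∑-*ʳ xs f c = trans (∑-cong xs (λ x → *-comm (f x) c)) (trans (∑-*ˡ xs c f) (*-comm c _))

∑-swap : {A B : Set} (xs : List A) (ys : List B) (f : A → B → ℕ) →
  ∑ xs (λ x → ∑ ys (f x)) ≡ ∑ ys (λ y → ∑ xs (λ x → f x y))
∑-swap []       ys f = sym (trans (∑-const ys 0) (*-zeroʳ (length ys)))
∑-swap (x ∷ xs) ys f = trans (cong (∑ ys (f x) +_) (∑-swap xs ys f)) (sym (∑-+ ys (f x) _))

∑≡0⇒≡0 : {A : Set} (xs : List A) (f : A → ℕ) → ∑ xs f ≡ 0 → ∀ {x} → x ∈ xs → f x ≡ 0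
∑≡0⇒≡0 (x ∷ xs) f eq (here refl) = m+n≡0⇒m≡0 (f x) eq
∑≡0⇒≡0 (x ∷ xs) f eq (there y∈)  = ∑≡0⇒≡0 xs f (m+n≡0⇒n≡0 (f x) eq) y∈

-- The first-moment method: a natural-valued function with mean below 1 vanishes somewhere. It is
-- used once over tournaments and once over orientations.
∑<length⇒∃0 : {A : Set} (xs : List A) (f : A → ℕ) → ∑ xs f < length xs → ∃[ x ] f x ≡ 0
∑<length⇒∃0 (x ∷ xs) f lt with f x in eq
... | zero  = x , eq
... | suc n = ∑<length⇒∃0 xs f (≤-trans (s≤s (m≤n+m _ n)) (s≤s⁻¹ lt))

∑-allFin-suc : ∀ n (f : Fin (suc n) → ℕ) → ∑ (allFin (suc n)) f ≡ f zero + ∑ (allFin n) (f ∘ suc)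
∑-allFin-suc n f = cong (λ l → f zero + sum l)
  (trans (map-tabulate suc f) (sym (map-tabulate id (f ∘ suc))))

length-allFin : ∀ n → length (allFin n) ≡ n
length-allFin n = length-tabulate id

does-sound : {P : Set} (P? : Dec P) → does P? ≡ true → P
does-sound (yes p) eq = p

_≡ᶠ_ : ∀ {n} → Fin n → Fin n → Bool
i ≡ᶠ j = does (i Fin.≟ j)

≡ᶠ-sound : ∀ {n} (i j : Fin n) → (i ≡ᶠ j) ≡ true → i ≡ j
≡ᶠ-sound i j = does-sound (i Fin.≟ j)

≡ᶠ-refl : ∀ {n} (i : Fin n) → (i ≡ᶠ i) ≡ true
≡ᶠ-refl i = dec-true (i Fin.≟ i) refl

≡ᶠ-≢ : ∀ {n} {i j : Fin n} → i ≢ j → (i ≡ᶠ j) ≡ false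
≡ᶠ-≢ {i = i} {j} = dec-false (i Fin.≟ j)

ind-mono : ∀ b {c} → (b ≡ true → 1 ≤ c) → ind b ≤ c
ind-mono true  p = p refl
ind-mono false p = z≤n

count : ∀ {n} → (Fin n → Bool) → ℕ
count {n} P = ∑ (allFin n) (ind ∘ P)

count-none : ∀ {n} (P : Fin n → Bool) → (∀ i → P i ≡ false) → count P ≡ 0
count-none {n} P none = trans (∑-cong (allFin n) (λ i → cong ind (none i)))
  (trans (∑-const (allFin n) 0) (*-zeroʳ (length (allFin n))))

∑-mem : ∀ {n} (f : Fin n → ℕ) i → f i ≤ ∑ (allFin n) f
∑-mem {suc n} f i rewrite ∑-allFin-suc n f with i
... | zero  = m≤m+n (f zero) _
... | suc j = ≤-trans (∑-mem (f ∘ suc) j) (m≤n+m _ (f zero))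

count≤1 : ∀ {n} (P : Fin n → Bool) → (∀ i j → P i ≡ true → P j ≡ true → i ≡ j) → count P ≤ 1
count≤1 {zero}  P u = z≤n
count≤1 {suc n} P u rewrite ∑-allFin-suc n (ind ∘ P) with P zero in eq
... | false = count≤1 (P ∘ suc) (λ i j p q → Fin.suc-injective (u (suc i) (suc j) p q))
... | true  = ≤-reflexive (cong suc (count-none (P ∘ suc) none))
  where
  none : ∀ i → P (suc i) ≡ false
  none i with P (suc i) in eq'
  ... | false = refl
  ... | true with () ← u zero (suc i) eq eq'

-- Double counting of the pairs `(i , y)` with `P i` and `f i ≡ y`: each such `i` lies in at least
-- one pair, each `y` in at most one.
count-≤-injection : ∀ {n m} (P : Fin n → Bool) (f : Fin n → Fin m) →
  (∀ i j → P i ≡ true → P j ≡ true → f i ≡ f j → i ≡ j) → count P ≤ m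
count-≤-injection {n} {m} P f inj = begin
  count P
    ≤⟨ ∑-mono (allFin n) (λ i → ind-mono (P i) (λ Pi → ≤-trans (≤-reflexive (sym (cong ind (hit i Pi)))) (∑-mem (λ y → ind (P i ∧ (f i ≡ᶠ y))) (f i)))) ⟩
  ∑ (allFin n) (λ i → ∑ (allFin m) (λ y → ind (P i ∧ (f i ≡ᶠ y))))
    ≡⟨ ∑-swap (allFin n) (allFin m) _ ⟩
  ∑ (allFin m) (λ y → count (λ i → P i ∧ (f i ≡ᶠ y)))
    ≤⟨ ∑-mono (allFin m) (λ y → count≤1 _ (unique y)) ⟩
  ∑ (allFin m) (λ _ → 1)
    ≡⟨ ∑-const (allFin m) 1 ⟩
  length (allFin m) * 1
    ≡⟨ trans (*-identityʳ _) (length-allFin m) ⟩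
  m ∎
  where
  open ≤-Reasoning
  hit : ∀ i → P i ≡ true → (P i ∧ (f i ≡ᶠ f i)) ≡ true
  hit i Pi rewrite Pi = ≡ᶠ-refl (f i)
  split : ∀ i y → (P i ∧ (f i ≡ᶠ y)) ≡ true → P i ≡ true × f i ≡ y
  split i y eq with P i
  ... | true = refl , ≡ᶠ-sound (f i) y eq
  unique : ∀ y i j → (P i ∧ (f i ≡ᶠ y)) ≡ true → (P j ∧ (f j ≡ᶠ y)) ≡ true → i ≡ j
  unique y i j p q with split i y p | split j y q
  ... | Pi , fi | Pj , fj = inj i j Pi Pj (trans fi (sym fj))

count-≥-injection : ∀ {n m} (P : Fin n → Bool) (g : Fin m → Fin n) →
  (∀ y z → g y ≡ g z → y ≡ z) → (∀ y → P (g y) ≡ true) → m ≤ count P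
count-≥-injection {n} {m} P g inj Pg = begin
  m
    ≡⟨ sym (trans (*-identityʳ _) (length-allFin m)) ⟩
  length (allFin m) * 1
    ≡⟨ sym (∑-const (allFin m) 1) ⟩
  ∑ (allFin m) (λ _ → 1)
    ≤⟨ ∑-mono (allFin m) (λ y → ≤-trans (≤-reflexive (sym (cong ind (≡ᶠ-refl (g y))))) (∑-mem (λ i → ind (g y ≡ᶠ i)) (g y))) ⟩
  ∑ (allFin m) (λ y → ∑ (allFin n) (λ i → ind (g y ≡ᶠ i)))
    ≡⟨ ∑-swap (allFin m) (allFin n) _ ⟩
  ∑ (allFin n) (λ i → count (λ y → g y ≡ᶠ i))
    ≤⟨ ∑-mono (allFin n) fibre ⟩
  count P ∎
  where
  open ≤-Reasoning
  fibre : ∀ i → count (λ y → g y ≡ᶠ i) ≤ ind (P i)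
  fibre i with P i in eq
  ... | true  = count≤1 _ (λ y z p q → inj y z (trans (≡ᶠ-sound (g y) i p) (sym (≡ᶠ-sound (g z) i q))))
  ... | false = ≤-reflexive (count-none _ (λ y → ≡ᶠ-≢ (λ gy≡i → case-false (trans (sym (Pg y)) (trans (cong P gy≡i) eq)))))
    where
    case-false : true ≢ false
    case-false ()

-- Otherwise choosing a preimage of each `d` would inject `Fin c` into the smaller `Fin j`.
fresh : ∀ {j c} (f : Fin j → Fin c) → j < c → ∃[ d ] (∀ i → d ≢ f i)
fresh {j} {c} f j<c with Fin.any? (λ d → Fin.all? (λ i → ¬? (d Fin.≟ f i)))
... | yes p = p
... | no ¬p = ⊥-elim (Fin.<⇒notInjective {f = λ d → proj₁ (pre d)} j<c
      (λ {x} {y} eq → trans (proj₂ (pre x)) (trans (cong f eq) (sym (proj₂ (pre y))))))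
  where
  pre : ∀ d → ∃[ i ] d ≡ f i
  pre d = decidable-stable (Fin.any? (λ i → d Fin.≟ f i)) (λ n → ¬p (d , λ i eq → n (i , eq)))

-- Product spaces of vectors

vecs : {A : Set} → ∀ n → List A → List (Vec A n)
vecs zero    xs = [] ∷ []
vecs (suc n) xs = cartesianProductWith _∷_ xs (vecs n xs)

∑-product : {A B C : Set} (h : A → B → C) (xs : List A) (ys : List B) (f : C → ℕ) →
  ∑ (cartesianProductWith h xs ys) f ≡ ∑ xs (λ x → ∑ ys (λ y → f (h x y)))
∑-product h []       ys f = refl
∑-product h (x ∷ xs) ys f = trans (∑-++ (map (h x) ys) _ f) (cong₂ _+_ (∑-map (h x) ys f) (∑-product h xs ys f))

length≡∑ : {A : Set} (xs : List A) → length xs ≡ ∑ xs (λ _ → 1)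
length≡∑ xs = sym (trans (∑-const xs 1) (*-identityʳ _))

length-product : {A B C : Set} (h : A → B → C) (xs : List A) (ys : List B) →
  length (cartesianProductWith h xs ys) ≡ length xs * length ys
length-product h []       ys = refl
length-product h (x ∷ xs) ys = trans (length-++ (map (h x) ys))
  (cong₂ _+_ (length-map (h x) ys) (length-product h xs ys))

length-vecs : {A : Set} (n : ℕ) (xs : List A) → length (vecs n xs) ≡ length xs ^ n
length-vecs zero    xs = refl
length-vecs (suc n) xs = trans (length-product _∷_ xs (vecs n xs)) (cong (length xs *_) (length-vecs n xs))

∈-vecs : {A : Set} {xs : List A} → (∀ x → x ∈ xs) → ∀ {n} (v : Vec A n) → v ∈ vecs n xs
∈-vecs all []      = here refl
∈-vecs all (x ∷ v) = cartesianProductWith⁺ _∷_ (λ { refl refl → refl }) (all x) (∈-vecs all v)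

∏ : ∀ {n} → (Fin n → ℕ) → ℕ
∏ {zero}  f = 1
∏ {suc n} f = f zero * ∏ (f ∘ suc)

∏-cong : ∀ {n} {f g : Fin n → ℕ} → (∀ i → f i ≡ g i) → ∏ f ≡ ∏ g
∏-cong {zero}  p = refl
∏-cong {suc n} p = cong₂ _*_ (p zero) (∏-cong (p ∘ suc))

∏≡0⇒∃0 : ∀ {n} (f : Fin n → ℕ) → ∏ f ≡ 0 → ∃[ i ] f i ≡ 0
∏≡0⇒∃0 {suc n} f eq with m*n≡0⇒m≡0∨n≡0 (f zero) eq
... | inj₁ z = zero , z
... | inj₂ z with ∏≡0⇒∃0 (f ∘ suc) z
... | i , fi = suc i , fi

-- Counting form of the fact that the coordinates of a uniform random vector are independent.
∑-vecs-∏ : {A : Set} (xs : List A) → ∀ {n} (f : Fin n → A → ℕ) →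
  ∑ (vecs n xs) (λ v → ∏ (λ i → f i (lookup v i))) ≡ ∏ (λ i → ∑ xs (f i))
∑-vecs-∏ xs {zero}  f = refl
∑-vecs-∏ xs {suc n} f = begin
  ∑ (vecs (suc n) xs) (λ v → ∏ (λ i → f i (lookup v i)))
    ≡⟨ ∑-product _∷_ xs (vecs n xs) _ ⟩
  ∑ xs (λ x → ∑ (vecs n xs) (λ v → f zero x * ∏ (λ i → f (suc i) (lookup v i))))
    ≡⟨ ∑-cong xs (λ x → ∑-*ˡ (vecs n xs) (f zero x) _) ⟩
  ∑ xs (λ x → f zero x * ∑ (vecs n xs) (λ v → ∏ (λ i → f (suc i) (lookup v i))))
    ≡⟨ ∑-*ʳ xs (f zero) _ ⟩
  ∑ xs (f zero) * ∑ (vecs n xs) (λ v → ∏ (λ i → f (suc i) (lookup v i)))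
    ≡⟨ cong (∑ xs (f zero) *_) (∑-vecs-∏ xs (f ∘ suc)) ⟩
  ∑ xs (f zero) * ∏ (λ i → ∑ xs (f (suc i))) ∎
  where open ≡-Reasoning

act : {A : Set} → ∀ {n} → (Fin n → A → A) → Vec A n → Vec A n
act π []      = []
act π (x ∷ v) = π zero x ∷ act (π ∘ suc) v

lookup-act : {A : Set} → ∀ {n} (π : Fin n → A → A) (v : Vec A n) i → lookup (act π v) i ≡ π i (lookup v i)
lookup-act π (x ∷ v) zero    = refl
lookup-act π (x ∷ v) (suc i) = lookup-act (π ∘ suc) v i

-- A coordinatewise measure-preserving map preserves the product measure. The hypothesis speaks of
-- sums rather than bijections, so that the lemma can be applied again to the rows of a matrix.
∑-act : {A : Set} (xs : List A) → ∀ {n} (π : Fin n → A → A) →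
  (∀ i f → ∑ xs (f ∘ π i) ≡ ∑ xs f) → ∀ F → ∑ (vecs n xs) (F ∘ act π) ≡ ∑ (vecs n xs) F
∑-act xs {zero}  π inv F = refl
∑-act xs {suc n} π inv F = begin
  ∑ (vecs (suc n) xs) (F ∘ act π)
    ≡⟨ ∑-product _∷_ xs (vecs n xs) _ ⟩
  ∑ xs (λ x → ∑ (vecs n xs) (λ v → F (π zero x ∷ act (π ∘ suc) v)))
    ≡⟨ ∑-cong xs (λ x → ∑-act xs (π ∘ suc) (inv ∘ suc) (λ v → F (π zero x ∷ v))) ⟩
  ∑ xs (λ x → ∑ (vecs n xs) (λ v → F (π zero x ∷ v)))
    ≡⟨ inv zero (λ x → ∑ (vecs n xs) (λ v → F (x ∷ v))) ⟩
  ∑ xs (λ x → ∑ (vecs n xs) (λ v → F (x ∷ v)))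
    ≡⟨ sym (∑-product _∷_ xs (vecs n xs) F) ⟩
  ∑ (vecs (suc n) xs) F ∎
  where open ≡-Reasoning

-- Numerical estimates

m≤m*m : ∀ m → m ≤ m * m
m≤m*m zero    = z≤n
m≤m*m (suc m) = m≤m*n (suc m) (suc m)

n<2^n : ∀ n → n < 2 ^ n
n<2^n zero    = s≤s z≤n
n<2^n (suc n) = begin
  suc (suc n)        ≡⟨ sym (+-comm (suc n) 1) ⟩
  suc n + 1          ≤⟨ +-mono-≤ (n<2^n n) (m^n>0 2 n) ⟩
  2 ^ n + 2 ^ n      ≡⟨ cong (2 ^ n +_) (sym (+-identityʳ (2 ^ n))) ⟩
  2 * 2 ^ n          ∎
  where open ≤-Reasoning

^-distribʳ-* : ∀ m n o → (m * n) ^ o ≡ m ^ o * n ^ o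
^-distribʳ-* m n zero    = refl
^-distribʳ-* m n (suc o) = trans (cong (m * n *_) (^-distribʳ-* m n o))
  (solve 4 (λ a b c d → a :* b :* (c :* d) := a :* c :* (b :* d)) refl m n (m ^ o) (n ^ o))

-- The first two terms of the binomial expansion of `suc x ^ suc n`. In the inductive step the added
-- term `suc n * x ^ n` completes a factor `suc x`.
bernoulli : ∀ x n → x ^ suc n + suc n * x ^ n ≤ suc x ^ suc n
bernoulli x zero    = ≤-reflexive (solve 1 (λ a → a :* con 1 :+ con 1 := (con 1 :+ a) :* con 1) refl x)
bernoulli x (suc n) = begin
  x * x ^ suc n + suc (suc n) * x ^ suc n
    ≤⟨ m≤m+n _ (suc n * x ^ n) ⟩
  x * x ^ suc n + suc (suc n) * x ^ suc n + suc n * x ^ n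
    ≡⟨ solve 3 (λ a m p → a :* (a :* p) :+ (con 2 :+ m) :* (a :* p) :+ (con 1 :+ m) :* p
         := (con 1 :+ a) :* (a :* p :+ (con 1 :+ m) :* p)) refl x n (x ^ n) ⟩
  suc x * (x ^ suc n + suc n * x ^ n)
    ≤⟨ *-monoʳ-≤ (suc x) (bernoulli x n) ⟩
  suc x * suc x ^ suc n ∎
  where open ≤-Reasoning

2*x^≤ : ∀ x → 2 * x ^ suc x ≤ suc x ^ suc x
2*x^≤ x = ≤-trans (≤-trans (≤-reflexive (cong (x ^ suc x +_) (+-identityʳ _)))
  (+-monoʳ-≤ (x ^ suc x) (m≤n+m _ (x ^ x)))) (bernoulli x x)

2^*x^≤ : ∀ x e → 2 ^ e * x ^ (suc x * e) ≤ suc x ^ (suc x * e)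
2^*x^≤ x e = begin
  2 ^ e * x ^ (suc x * e)    ≡⟨ cong (2 ^ e *_) (sym (^-*-assoc x (suc x) e)) ⟩
  2 ^ e * (x ^ suc x) ^ e    ≡⟨ sym (^-distribʳ-* 2 (x ^ suc x) e) ⟩
  (2 * x ^ suc x) ^ e        ≤⟨ ^-monoˡ-≤ e (2*x^≤ x) ⟩
  (suc x ^ suc x) ^ e        ≡⟨ ^-*-assoc (suc x) (suc x) e ⟩
  suc x ^ (suc x * e)        ∎
  where open ≤-Reasoning

-- With J = `suc x` this is c (1 - 1/J)^(J e) < 1: every J factors 1 - 1/J at least halve the
-- product. It closes both counts, that of tasks and that of codes.
*x^< : ∀ x .{{_ : NonZero x}} c e → c < 2 ^ e → c * x ^ (suc x * e) < suc x ^ (suc x * e)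
*x^< x c e lt = <-≤-trans (*-monoˡ-< (x ^ (suc x * e)) {{m^n≢0 x (suc x * e)}} lt) (2^*x^≤ x e)

-- For Δ = 4 + q this is (Δ - 3)(Δ - 1), written without truncated subtraction.
blocks : ℕ → ℕ
blocks q = (1 + q) * (3 + q)

-- Since 49/25 < 2, the ratio 7/5 is a rational substitute for the square root of 2.
square-ratio : ∀ a b → 5 * a ≤ 7 * b → a * a ≤ 2 * (b * b)
square-ratio a b le = *-cancelˡ-≤ 25 (begin
  25 * (a * a)              ≡⟨ solve 1 (λ x → con 25 :* (x :* x) := (con 5 :* x) :* (con 5 :* x)) refl a ⟩
  (5 * a) * (5 * a)         ≤⟨ *-mono-≤ le le ⟩
  (7 * b) * (7 * b)         ≤⟨ m≤m+n _ (b * b) ⟩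
  (7 * b) * (7 * b) + b * b ≡⟨ solve 1 (λ x → (con 7 :* x) :* (con 7 :* x) :+ x :* x := con 25 :* (con 2 :* (x :* x))) refl b ⟩
  25 * (2 * (b * b))        ∎)
  where open ≤-Reasoning

-- The two sides differ by 2 q² - 2 q - 19; `19 ≤ q` absorbs the constant into the linear term,
-- which q² then dominates.
blocks-ratio : ∀ q → 19 ≤ q → 5 * blocks (suc q) ≤ 7 * blocks q
blocks-ratio q 19≤q = begin
  5 * blocks (suc q)
    ≡⟨ solve 1 (λ x → con 5 :* ((con 2 :+ x) :* (con 4 :+ x))
         := (con 5 :* (x :* x) :+ con 28 :* x :+ con 21) :+ (con 19 :+ x :+ x)) refl q ⟩
  (5 * (q * q) + 28 * q + 21) + (19 + q + q)
    ≤⟨ +-monoʳ-≤ (5 * (q * q) + 28 * q + 21) (+-monoˡ-≤ q (+-monoˡ-≤ q 19≤q)) ⟩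
  (5 * (q * q) + 28 * q + 21) + (q + q + q)
    ≤⟨ +-monoʳ-≤ (5 * (q * q) + 28 * q + 21) (≤-trans (≤-reflexive
         (solve 1 (λ x → x :+ x :+ x := con 3 :* x) refl q)) (*-monoˡ-≤ q (≤-trans (s≤s (s≤s (s≤s z≤n))) 19≤q))) ⟩
  (5 * (q * q) + 28 * q + 21) + q * q
    ≤⟨ m≤m+n _ (q * q) ⟩
  (5 * (q * q) + 28 * q + 21) + q * q + q * q
    ≡⟨ solve 1 (λ x → (con 5 :* (x :* x) :+ con 28 :* x :+ con 21) :+ x :* x :+ x :* x
         := con 7 :* ((con 1 :+ x) :* (con 3 :+ x))) refl q ⟩
  7 * blocks q ∎
  where open ≤-Reasoning

-- Raising q by one doubles the right side and at most doubles the left. The base q = 25, which is Δ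
-- = 29, is decided by evaluation. The factor 2^8 is slack for the count of tasks.
blocks²≤ : ∀ {q} → 25 ≤′ q → blocks q * blocks q * 2 ^ 8 ≤ 2 ^ (3 + q)
blocks²≤ ≤′-refl              = ≤ᵇ⇒≤ _ _ tt
blocks²≤ (≤′-step {q} 25≤′q) = begin
  blocks (suc q) * blocks (suc q) * 2 ^ 8
    ≤⟨ *-monoˡ-≤ (2 ^ 8) (square-ratio (blocks (suc q)) (blocks q)
         (blocks-ratio q (≤-trans (m≤m+n 19 6) (≤′⇒≤ 25≤′q)))) ⟩
  2 * (blocks q * blocks q) * 2 ^ 8
    ≡⟨ *-assoc 2 (blocks q * blocks q) (2 ^ 8) ⟩
  2 * (blocks q * blocks q * 2 ^ 8)
    ≤⟨ *-monoʳ-≤ 2 (blocks²≤ 25≤′q) ⟩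
  2 ^ (4 + q) ∎
  where open ≤-Reasoning

-- Random tournaments

true≢false : true ≢ false
true≢false ()

bools : List Bool
bools = true ∷ false ∷ []

∈-bools : ∀ b → b ∈ bools
∈-bools true  = here refl
∈-bools false = there (here refl)

∑-bools-xor : ∀ x (f : Bool → ℕ) → ∑ bools (f ∘ (x xor_)) ≡ ∑ bools f
∑-bools-xor false f = refl
∑-bools-xor true  f = begin
  f false + (f true + 0) ≡⟨ cong (f false +_) (+-identityʳ (f true)) ⟩
  f false + f true       ≡⟨ +-comm (f false) (f true) ⟩
  f true + f false       ≡⟨ cong (f true +_) (sym (+-identityʳ (f false))) ⟩
  f true + (f false + 0) ∎
  where open ≡-Reasoning

infixl 6 _⊕_
_⊕_ : ∀ {n} → (Fin n → Bool) → Vec Bool n → Vec Bool n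
r ⊕ v = act (λ i → r i xor_) v

∑-⊕ : ∀ {n} (r : Fin n → Bool) (f : Vec Bool n → ℕ) →
  ∑ (vecs n bools) (λ v → f (r ⊕ v)) ≡ ∑ (vecs n bools) f
∑-⊕ r f = ∑-act bools (λ i → r i xor_) (λ i → ∑-bools-xor (r i)) f

vec-ext : {A : Set} → ∀ {n} {u v : Vec A n} → (∀ i → lookup u i ≡ lookup v i) → u ≡ v
vec-ext {u = u} {v} p = trans (sym (tabulate∘lookup u)) (trans (tabulate-cong p) (tabulate∘lookup v))

Matrix : ℕ → Set
Matrix c = Vec (Vec Bool c) c

at : ∀ {c} → Matrix c → Fin c → Fin c → Bool
at h a b = lookup (lookup h a) b

below : ∀ {c} → Fin c → Fin c → Bool
below a b = does (a <? b)

below-flip : ∀ {c} (a b : Fin c) → a ≢ b → below a b ≡ not (below b a)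
below-flip a b a≢b with Fin.<-cmp a b
... | tri< a<b _ b≮a = trans (dec-true (a <? b) a<b) (cong not (sym (dec-false (b <? a) b≮a)))
... | tri≈ _ a≡b _   = ⊥-elim (a≢b a≡b)
... | tri> a≮b _ b<a = trans (dec-false (a <? b) a≮b) (cong not (sym (dec-true (b <? a) b<a)))

-- Symmetrising h by xor makes row a of h an independent source of randomness for the arcs at a.
beats : ∀ {c} → Matrix c → Fin c → Fin c → Bool
beats h a b = (at h a b xor at h b a) xor below a b

-- The xor of the two matrix entries is symmetric in `a` and `b`, and `below` changes its value when
-- they are swapped.
beats-flip : ∀ {c} (h : Matrix c) a b → a ≢ b → beats h a b ≡ not (beats h b a)
beats-flip h a b a≢b rewrite below-flip a b a≢b =
  trans (cong (_xor not (below b a)) (Bool.xor-comm (at h a b) (at h b a)))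
    (sym (Bool.not-distribʳ-xor (at h b a xor at h a b) (below b a)))

mem : ∀ {n j} → Vec (Fin n) j → Fin n → Bool
mem []      a = false
mem (x ∷ A) a = (a ≡ᶠ x) ∨ mem A a

mem-lookup : ∀ {n j} (A : Vec (Fin n) j) i → mem A (lookup A i) ≡ true
mem-lookup (x ∷ A) zero rewrite ≡ᶠ-refl x = refl
mem-lookup (x ∷ A) (suc i) with lookup A i ≡ᶠ x
... | true  = refl
... | false = mem-lookup A i

∉-mem : ∀ {n j} (A : Vec (Fin n) j) {a} → mem A a ≡ false → ∀ i → a ≢ lookup A i
∉-mem A eq i refl = true≢false (trans (sym (mem-lookup A i)) eq)

pick : ∀ {n j} → Vec (Fin n) j → Vec Bool j → Fin n → Bool
pick []      []      y = false
pick (x ∷ A) (b ∷ g) y = if y ≡ᶠ x then b else pick A g y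

Distinct : ∀ {n j} → Vec (Fin n) j → Set
Distinct A = ∀ i j → lookup A i ≡ lookup A j → i ≡ j

distinct? : ∀ {n j} (A : Vec (Fin n) j) → Dec (Distinct A)
distinct? A = Fin.all? (λ i → Fin.all? (λ j → (lookup A i Fin.≟ lookup A j) →-dec (i Fin.≟ j)))

pick-lookup : ∀ {n j} (A : Vec (Fin n) j) (g : Vec Bool j) → Distinct A → ∀ i → pick A g (lookup A i) ≡ lookup g i
pick-lookup (x ∷ A) (b ∷ g) d zero rewrite ≡ᶠ-refl x = refl
pick-lookup (x ∷ A) (b ∷ g) d (suc i)
  rewrite ≡ᶠ-≢ {i = lookup A i} {x} (λ eq → Fin.0≢1+n (sym (d (suc i) zero eq)))
  = pick-lookup A g (λ i j eq → Fin.suc-injective (d (suc i) (suc j) eq)) i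

row : ∀ {c k} → Matrix c → Fin c → Vec (Fin c) k → Vec Bool k
row h a A = Vec.map (beats h a) A

module _ {c k} (A : Vec (Fin c) k) where

  -- Rows belonging to `A` stay fixed. Hence, of the two entries that determine the arc between some
  -- `a` outside `A` and a member of `A`, only the one in row `a` can change.
  mask : Vec (Vec Bool k) c → Fin c → Fin c → Bool
  mask g x y = if mem A x then false else pick A (lookup g x) y

  shift : Vec (Vec Bool k) c → Matrix c → Matrix c
  shift g = act (λ x → mask g x ⊕_)

  at-shift : ∀ g h x y → at (shift g h) x y ≡ mask g x y xor at h x y
  at-shift g h x y = trans (cong (λ v → lookup v y) (lookup-act (λ x → mask g x ⊕_) h x))
    (lookup-act (λ i → mask g x i xor_) (lookup h x) y)

  ∑-shift : ∀ g F → ∑ (vecs c (vecs c bools)) (F ∘ shift g) ≡ ∑ (vecs c (vecs c bools)) F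
  ∑-shift g F = ∑-act (vecs c bools) (λ x → mask g x ⊕_) (λ x → ∑-⊕ (mask g x)) F

  -- The pattern of `a` towards `A` is translated by `lookup g a` alone, so a random `g` makes the
  -- patterns of all vertices outside `A` uniform and independent.
  row-shift : Distinct A → ∀ g h a → mem A a ≡ false → row (shift g h) a A ≡ lookup (row h a A) ⊕ lookup g a
  row-shift d g h a a∉A = vec-ext λ i → begin
    lookup (row (shift g h) a A) i
      ≡⟨ lookup-map i (beats (shift g h) a) A ⟩
    beats (shift g h) a (lookup A i)
      ≡⟨ cong₂ (λ u v → (u xor v) xor below a (lookup A i)) (at-shift g h a (lookup A i)) (at-shift g h (lookup A i) a) ⟩
    ((mask g a (lookup A i) xor at h a (lookup A i)) xor (mask g (lookup A i) a xor at h (lookup A i) a)) xor below a (lookup A i)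
      ≡⟨ cong₂ (λ u v → ((u xor at h a (lookup A i)) xor (v xor at h (lookup A i) a)) xor below a (lookup A i)) (own i) (other i) ⟩
    ((lookup (lookup g a) i xor at h a (lookup A i)) xor at h (lookup A i) a) xor below a (lookup A i)
      ≡⟨ regroup (lookup (lookup g a) i) _ _ _ ⟩
    beats h a (lookup A i) xor lookup (lookup g a) i
      ≡⟨ cong (_xor lookup (lookup g a) i) (sym (lookup-map i (beats h a) A)) ⟩
    lookup (row h a A) i xor lookup (lookup g a) i
      ≡⟨ sym (lookup-act (λ i → lookup (row h a A) i xor_) (lookup g a) i) ⟩
    lookup (lookup (row h a A) ⊕ lookup g a) i ∎
    where
    open ≡-Reasoning
    own : ∀ i → mask g a (lookup A i) ≡ lookup (lookup g a) i
    own i rewrite a∉A = pick-lookup A (lookup g a) d i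
    other : ∀ i → mask g (lookup A i) a ≡ false
    other i rewrite mem-lookup A i = refl
    regroup : ∀ x y z w → ((x xor y) xor z) xor w ≡ ((y xor z) xor w) xor x
    regroup x y z w = trans (cong (_xor w) (Bool.xor-assoc x y z))
      (trans (Bool.xor-assoc x (y xor z) w) (Bool.xor-comm x ((y xor z) xor w)))

neq : ∀ {n} → Vec Bool n → Vec Bool n → ℕ
neq []      []      = 0
neq (x ∷ u) (y ∷ v) = if x xor y then 1 else neq u v

neq≡0⇒≡ : ∀ {n} (u v : Vec Bool n) → neq u v ≡ 0 → u ≡ v
neq≡0⇒≡ []          []          eq = refl
neq≡0⇒≡ (true  ∷ u) (true  ∷ v) eq = cong (true ∷_) (neq≡0⇒≡ u v eq)
neq≡0⇒≡ (false ∷ u) (false ∷ v) eq = cong (false ∷_) (neq≡0⇒≡ u v eq)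

∑-vecs-1 : ∀ n → ∑ (vecs n bools) (λ _ → 1) ≡ 2 ^ n
∑-vecs-1 n = trans (sym (length≡∑ (vecs n bools))) (length-vecs n bools)

suc-∑-neq : ∀ {n} (u : Vec Bool n) → suc (∑ (vecs n bools) (neq u)) ≡ 2 ^ n
suc-∑-neq []              = refl
suc-∑-neq {suc n} (x ∷ u) = trans (cong suc (∑-product _∷_ bools (vecs n bools) (neq (x ∷ u)))) (halves x)
  where
  open ≡-Reasoning
  S : ℕ
  S = ∑ (vecs n bools) (neq u)
  halves : ∀ x → suc (∑ bools (λ y → ∑ (vecs n bools) (λ v → neq (x ∷ u) (y ∷ v)))) ≡ 2 * 2 ^ n
  halves true = begin
    suc S + (∑ (vecs n bools) (λ _ → 1) + 0) ≡⟨ cong₂ (λ a b → a + (b + 0)) (suc-∑-neq u) (∑-vecs-1 n) ⟩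
    2 * 2 ^ n ∎
  halves false = begin
    suc (∑ (vecs n bools) (λ _ → 1) + (S + 0)) ≡⟨ sym (+-suc _ (S + 0)) ⟩
    ∑ (vecs n bools) (λ _ → 1) + (suc S + 0) ≡⟨ cong₂ (λ a b → a + (b + 0)) (∑-vecs-1 n) (suc-∑-neq u) ⟩
    2 * 2 ^ n ∎

-- The indicator that `r` is neither `p` nor its complement: the first entries determine the only
-- possible sign, and the others are compared under it. Indicators of failure are chosen because
-- they multiply over the candidate vertices.
miss : ∀ {n} → Vec Bool (suc n) → Vec Bool (suc n) → ℕ
miss (p ∷ ps) (r ∷ rs) = neq (Vec.map ((r xor p) xor_) ps) rs

xor-cancel : ∀ x y → (x xor y) xor x ≡ y
xor-cancel true  true  = refl
xor-cancel true  false = refl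
xor-cancel false true  = refl
xor-cancel false false = refl

xor-cancel′ : ∀ x y → x xor (x xor y) ≡ y
xor-cancel′ true  true  = refl
xor-cancel′ true  false = refl
xor-cancel′ false y     = refl

miss≡0⇒match : ∀ {n} (p r : Vec Bool (suc n)) → miss p r ≡ 0 → ∃[ s ] (∀ i → lookup r i xor s ≡ lookup p i)
miss≡0⇒match (p ∷ ps) (r ∷ rs) eq = r xor p , λ where
  zero    → xor-cancel′ r p
  (suc i) → trans (cong (λ v → lookup v i xor (r xor p)) (sym (neq≡0⇒≡ (Vec.map ((r xor p) xor_) ps) rs eq)))
    (trans (cong (_xor (r xor p)) (lookup-map i ((r xor p) xor_) ps)) (xor-cancel (r xor p) (lookup ps i)))

-- Among the 2^(n+1) patterns only `p` and its complement are hits, one for each value of the first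
-- entry.
∑-miss : ∀ {n} (p : Vec Bool (suc n)) {x} → suc x ≡ 2 ^ n → ∑ (vecs (suc n) bools) (miss p) ≡ 2 * x
∑-miss {n} (p ∷ ps) {x} eq = trans (∑-product _∷_ bools (vecs n bools) (miss (p ∷ ps)))
  (cong₂ (λ a b → a + (b + 0)) (part true) (part false))
  where
  part : ∀ r → ∑ (vecs n bools) (neq (Vec.map ((r xor p) xor_) ps)) ≡ x
  part r = suc-injective (trans (suc-∑-neq (Vec.map ((r xor p) xor_) ps)) (sym eq))

∏-if : ∀ {n} (b : Fin n → Bool) x y → ∏ (λ a → if b a then x else y) ≡ x ^ count b * y ^ count (not ∘ b)
∏-if {zero}  b x y = refl
∏-if {suc n} b x y
  rewrite ∑-allFin-suc n (ind ∘ b) | ∑-allFin-suc n (ind ∘ not ∘ b) | ∏-if (b ∘ suc) x y with b zero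
... | true  = sym (*-assoc x _ _)
... | false = x∙yz≈y∙xz *-commutativeSemigroup y (x ^ count (b ∘ suc)) _

count-not : ∀ {n} (b : Fin n → Bool) → count b + count (not ∘ b) ≡ n
count-not {n} b = trans (sym (∑-+ (allFin n) (ind ∘ b) (ind ∘ not ∘ b)))
  (trans (∑-cong (allFin n) (one ∘ b)) (trans (sym (length≡∑ (allFin n))) (length-allFin n)))
  where
  one : ∀ x → ind x + ind (not x) ≡ 1
  one true  = refl
  one false = refl

-- Trading a factor `y` for a factor `x` does not decrease the product, so the size of `b` may be
-- replaced by its upper bound `X`. The fixed exponents make the bound uniform over tasks.
∏-if-≤ : ∀ {n} (b : Fin n → Bool) {x y} → y ≤ x → ∀ X Y → X + Y ≡ n → count b ≤ X →
  ∏ (λ a → if b a then x else y) ≤ x ^ X * y ^ Y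
∏-if-≤ {n} b {x} {y} y≤x X Y X+Y≡n le with m≤n⇒∃[o]m+o≡n le
... | d , refl = begin
  ∏ (λ a → if b a then x else y)           ≡⟨ ∏-if b x y ⟩
  x ^ count b * y ^ count (not ∘ b)        ≡⟨ cong (λ z → x ^ count b * y ^ z) rest ⟩
  x ^ count b * y ^ (d + Y)                ≡⟨ cong (x ^ count b *_) (^-distribˡ-+-* y d Y) ⟩
  x ^ count b * (y ^ d * y ^ Y)            ≡⟨ sym (*-assoc (x ^ count b) _ _) ⟩
  x ^ count b * y ^ d * y ^ Y              ≤⟨ *-monoˡ-≤ (y ^ Y) (*-monoʳ-≤ (x ^ count b) (^-monoˡ-≤ d y≤x)) ⟩
  x ^ count b * x ^ d * y ^ Y              ≡⟨ cong (_* y ^ Y) (sym (^-distribˡ-+-* x (count b) d)) ⟩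
  x ^ (count b + d) * y ^ Y                ∎
  where
  open ≤-Reasoning
  rest : count (not ∘ b) ≡ d + Y
  rest = +-cancelˡ-≡ (count b) _ _ (trans (count-not b) (trans (sym X+Y≡n) (+-assoc (count b) d Y)))

count-∨ : ∀ {n} (b c : Fin n → Bool) → count (λ a → b a ∨ c a) ≤ count b + count c
count-∨ {n} b c = ≤-trans (∑-mono (allFin n) (λ a → le (b a) (c a))) (≤-reflexive (∑-+ (allFin n) (ind ∘ b) (ind ∘ c)))
  where
  le : ∀ x y → ind (x ∨ y) ≤ ind x + ind y
  le true  y = s≤s z≤n
  le false y = ≤-refl

count-mem : ∀ {n m j} (β : Fin n → Fin m) w → (∀ y → count (λ a → β a ≡ᶠ y) ≤ w) →
  (F : Vec (Fin m) j) → count (mem F ∘ β) ≤ j * w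
count-mem {n} β w fib []      = ≤-reflexive (count-none {n} (λ _ → false) (λ _ → refl))
count-mem     β w fib (y ∷ F) = ≤-trans (count-∨ (λ a → β a ≡ᶠ y) (mem F ∘ β)) (+-mono-≤ (fib y) (count-mem β w fib F))

-- An existential closure property of tournaments, up to a sign: `s` records whether the new vertex
-- is pushed. `F` may repeat blocks, so avoiding fewer than `k` of them is covered.
Extends : ∀ {c Q} → (Fin c → Fin c → Bool) → (Fin c → Fin Q) → ℕ → Set
Extends {c} {Q} T β k = ∀ (A : Fin k → Fin c) (p : Fin k → Bool) (F : Fin k → Fin Q) →
  (∀ i j → A i ≡ A j → i ≡ j) →
  ∃[ a ] ∃[ s ] ((∀ i → a ≢ A i) × (∀ i → T a (A i) xor s ≡ p i) × (∀ i → β a ≢ F i))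

-- `X` bounds the number of excluded candidates; at least `Y` remain, each failing with probability
-- x / 2^k. `few` says that the number of tasks times the failure probability is below 1. The tuples
-- have length `suc k` because `miss` needs a first entry.
module Random {c Q k w x X Y : ℕ} (β : Fin c → Fin Q) (fibre : ∀ y → count (λ a → β a ≡ᶠ y) ≤ w)
  (eqx : suc x ≡ 2 ^ k) (eqc : X + Y ≡ c) (exc : suc k + suc k * w ≤ X)
  (few : c ^ suc k * (2 ^ suc k * Q ^ suc k) * ((2 ^ suc k) ^ X * (2 * x) ^ Y) < (2 ^ suc k) ^ c) where

  Task : Set
  Task = Vec (Fin c) (suc k) × Vec Bool (suc k) × Vec (Fin Q) (suc k)

  tasks : List Task
  tasks = cartesianProduct (filter distinct? (vecs (suc k) (allFin c)))
    (cartesianProduct (vecs (suc k) bools) (vecs (suc k) (allFin Q)))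

  Ω : List (Matrix c)
  Ω = vecs c (vecs c bools)

  Γ : List (Vec (Vec Bool (suc k)) c)
  Γ = vecs c (vecs (suc k) bools)

  excluded : Task → Fin c → Bool
  excluded (A , p , F) a = mem A a ∨ mem F (β a)

  -- 1 if no colour solves the task in the tournament of h, and 0 if some colour does.
  bad : Task → Matrix c → ℕ
  bad t@(A , p , F) h = ∏ (λ a → if excluded t a then 1 else miss p (row h a A))

  count-excluded : ∀ t → count (excluded t) ≤ X
  count-excluded t@(A , p , F) = begin
    count (excluded t)
      ≤⟨ count-∨ (mem A) (mem F ∘ β) ⟩
    count (mem A) + count (mem F ∘ β)
      ≤⟨ +-mono-≤ (count-mem id 1 (λ y → count≤1 _ (λ i j p q → trans (≡ᶠ-sound i y p) (sym (≡ᶠ-sound j y q)))) A) (count-mem β w fibre F) ⟩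
    suc k * 1 + suc k * w
      ≡⟨ cong (_+ suc k * w) (*-identityʳ (suc k)) ⟩
    suc k + suc k * w
      ≤⟨ exc ⟩
    X ∎
    where open ≤-Reasoning

  W : ℕ
  W = (2 ^ suc k) ^ X * (2 * x) ^ Y

  -- Averaged over the shifts of h, the factors of bad at different colours become independent.
  ∑-bad-shift : ∀ t h → Distinct (proj₁ t) → ∑ Γ (λ g → bad t (shift (proj₁ t) g h)) ≤ W
  ∑-bad-shift t@(A , p , F) h d = begin
    ∑ Γ (λ g → bad t (shift A g h))
      ≡⟨ ∑-cong Γ (λ g → ∏-cong (factor g)) ⟩
    ∑ Γ (λ g → ∏ (λ a → φ a (lookup g a)))
      ≡⟨ ∑-vecs-∏ (vecs (suc k) bools) φ ⟩
    ∏ (λ a → ∑ (vecs (suc k) bools) (φ a))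
      ≡⟨ ∏-cong total ⟩
    ∏ (λ a → if excluded t a then 2 ^ suc k else 2 * x)
      ≤⟨ ∏-if-≤ (excluded t) (*-monoʳ-≤ 2 (≤-trans (n≤1+n x) (≤-reflexive eqx))) X Y eqc (count-excluded t) ⟩
    W ∎
    where
    open ≤-Reasoning
    φ : Fin c → Vec Bool (suc k) → ℕ
    φ a v = if excluded t a then 1 else miss p (lookup (row h a A) ⊕ v)
    factor : ∀ g a → (if excluded t a then 1 else miss p (row (shift A g h) a A)) ≡ φ a (lookup g a)
    factor g a with mem A a in a∉A | mem F (β a)
    ... | true  | _     = refl
    ... | false | true  = refl
    ... | false | false = cong (miss p) (row-shift A d g h a a∉A)
    total : ∀ a → ∑ (vecs (suc k) bools) (φ a) ≡ (if excluded t a then 2 ^ suc k else 2 * x)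
    total a with excluded t a
    ... | true  = ∑-vecs-1 (suc k)
    ... | false = trans (∑-⊕ (lookup (row h a A)) (miss p)) (∑-miss p eqx)

  length-Γ : length Γ ≡ (2 ^ suc k) ^ c
  length-Γ = trans (length-vecs c _) (cong (_^ c) (length-vecs (suc k) bools))

  -- Every shift preserves sums over `Ω`, so averaging over `Γ` changes nothing; after exchanging
  -- the sums, the bound for a fixed `h` applies.
  ∑-bad : ∀ t → Distinct (proj₁ t) → (2 ^ suc k) ^ c * ∑ Ω (bad t) ≤ length Ω * W
  ∑-bad t@(A , p , F) d = begin
    (2 ^ suc k) ^ c * ∑ Ω (bad t)                      ≡⟨ cong (_* ∑ Ω (bad t)) (sym length-Γ) ⟩
    length Γ * ∑ Ω (bad t)                             ≡⟨ sym (∑-const Γ _) ⟩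
    ∑ Γ (λ g → ∑ Ω (bad t))                            ≡⟨ ∑-cong Γ (λ g → sym (∑-shift A g (bad t))) ⟩
    ∑ Γ (λ g → ∑ Ω (λ h → bad t (shift A g h)))        ≡⟨ ∑-swap Γ Ω _ ⟩
    ∑ Ω (λ h → ∑ Γ (λ g → bad t (shift A g h)))        ≤⟨ ∑-mono Ω (λ h → ∑-bad-shift t h d) ⟩
    ∑ Ω (λ _ → W)                                      ≡⟨ ∑-const Ω W ⟩
    length Ω * W                                       ∎
    where open ≤-Reasoning

  length-tasks : length tasks ≤ c ^ suc k * (2 ^ suc k * Q ^ suc k)
  length-tasks = begin
    length tasks
      ≡⟨ trans (length-product _,_ As _) (cong (length As *_) (length-product _,_ (vecs (suc k) bools) (vecs (suc k) (allFin Q)))) ⟩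
    length As * (length (vecs (suc k) bools) * length (vecs (suc k) (allFin Q)))
      ≤⟨ *-mono-≤ (≤-trans (length-filter distinct? (vecs (suc k) (allFin c))) (≤-reflexive (length-tuples c)))
           (≤-reflexive (cong₂ _*_ (length-vecs (suc k) bools) (length-tuples Q))) ⟩
    c ^ suc k * (2 ^ suc k * Q ^ suc k) ∎
    where
    open ≤-Reasoning
    As : List (Vec (Fin c) (suc k))
    As = filter distinct? (vecs (suc k) (allFin c))
    length-tuples : ∀ n → length (vecs (suc k) (allFin n)) ≡ n ^ suc k
    length-tuples n = trans (length-vecs (suc k) (allFin n)) (cong (_^ suc k) (length-allFin n))

  ∈-tasks⇒distinct : ∀ t → t ∈ tasks → Distinct (proj₁ t)
  ∈-tasks⇒distinct t t∈ = proj₂ (∈-filter⁻ distinct? {xs = vecs (suc k) (allFin c)} (proj₁ (∈-cartesianProduct⁻ _ _ t∈)))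

  -- The union bound over tasks, multiplied through by the size of `Γ` to stay within the natural
  -- numbers.
  total-bad : ∑ Ω (λ h → ∑ tasks (λ t → bad t h)) < length Ω
  total-bad = *-cancelˡ-< ((2 ^ suc k) ^ c) _ _ (begin-strict
    (2 ^ suc k) ^ c * ∑ Ω (λ h → ∑ tasks (λ t → bad t h))
      ≡⟨ cong ((2 ^ suc k) ^ c *_) (∑-swap Ω tasks _) ⟩
    (2 ^ suc k) ^ c * ∑ tasks (λ t → ∑ Ω (bad t))
      ≡⟨ sym (∑-*ˡ tasks ((2 ^ suc k) ^ c) _) ⟩
    ∑ tasks (λ t → (2 ^ suc k) ^ c * ∑ Ω (bad t))
      ≤⟨ ∑-mono-∈ tasks (λ t t∈ → ∑-bad t (∈-tasks⇒distinct t t∈)) ⟩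
    ∑ tasks (λ _ → length Ω * W)
      ≡⟨ ∑-const tasks _ ⟩
    length tasks * (length Ω * W)
      ≡⟨ trans (cong (length tasks *_) (*-comm (length Ω) W)) (sym (*-assoc (length tasks) W (length Ω))) ⟩
    length tasks * W * length Ω
      ≤⟨ *-monoˡ-≤ (length Ω) (*-monoˡ-≤ W length-tasks) ⟩
    c ^ suc k * (2 ^ suc k * Q ^ suc k) * W * length Ω
      <⟨ *-monoˡ-< (length Ω) {{nonempty}} few ⟩
    (2 ^ suc k) ^ c * length Ω ∎)
    where
    open ≤-Reasoning
    nonempty : NonZero (length Ω)
    nonempty = subst NonZero (sym (trans (length-vecs c (vecs c bools)) (cong (_^ c) (length-vecs c bools))))
      (m^n≢0 (2 ^ c) c {{m^n≢0 2 c}})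

  ∃-extends : Σ (Matrix c) λ h → Extends (beats h) β (suc k)
  ∃-extends with ∑<length⇒∃0 Ω _ total-bad
  ... | h , none = h , extend
    where
    extend : Extends (beats h) β (suc k)
    extend A p F inj with ∏≡0⇒∃0 _ (∑≡0⇒≡0 tasks (λ t → bad t h) none t∈)
      where
      dist : Distinct (tabulate A)
      dist i j eq = inj i j (trans (sym (lookup∘tabulate A i)) (trans eq (lookup∘tabulate A j)))
      t∈ : (tabulate A , tabulate p , tabulate F) ∈ tasks
      t∈ = ∈-cartesianProduct⁺ (∈-filter⁺ distinct? (∈-vecs ∈-allFin (tabulate A)) dist)
        (∈-cartesianProduct⁺ (∈-vecs ∈-bools (tabulate p)) (∈-vecs ∈-allFin (tabulate F)))
    ... | a , zero-factor with mem (tabulate A) a in a∉A | mem (tabulate F) (β a) in a∉F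
    -- An excluded vertex contributes the factor 1, so the vanishing factor belongs to a vertex
    -- outside `A` and outside the forbidden blocks.
    ... | false | false with miss≡0⇒match (tabulate p) _ zero-factor
    ... | s , match = a , s
      , (λ i eq → ∉-mem (tabulate A) a∉A i (trans eq (sym (lookup∘tabulate A i))))
      , (λ i → trans (cong (_xor s) (sym (trans (lookup-map i (beats h a) (tabulate A)) (cong (beats h a) (lookup∘tabulate A i)))))
                 (trans (match i) (lookup∘tabulate p i)))
      , (λ i eq → ∉-mem (tabulate F) a∉F i (trans eq (sym (lookup∘tabulate F i))))

-- Choosing the parameters of the tournament

count-quotient : ∀ {m} n (y : Fin m) → count (λ a → quotient {m} n a ≡ᶠ y) ≤ n
count-quotient {m} n y = count-≤-injection _ (remainder {m} n) λ i j p q eq →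
  trans (sym (Fin.combine-remQuot {m} n i))
    (trans (cong₂ combine (trans (≡ᶠ-sound _ y p) (sym (≡ᶠ-sound _ y q))) eq) (Fin.combine-remQuot {m} n j))

-- The left side is (2 Q² 2^k)^k. Multiplied by 2^(8k) it is at most 2^(k(2k+1)), by the hypothesis
-- on `Q`, while the right side becomes 2^(2k² + 2k - 1), because q = k - 3.
tasks<2^ : ∀ Q k q e → Q * Q * 2 ^ 8 ≤ 2 ^ k → k ≡ 3 + q → suc e ≡ 2 * (k * q) →
  (Q * 2 ^ k) ^ k * (2 ^ k * Q ^ k) < 2 ^ e
tasks<2^ Q k q e Q²≤ k≡ e≡ = *-cancelʳ-< (2 ^ (8 * k)) _ _ (begin-strict
  (Q * 2 ^ k) ^ k * (2 ^ k * Q ^ k) * 2 ^ (8 * k)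
    ≡⟨ cong₂ (λ u v → (Q * 2 ^ k) ^ k * u * v) (sym (^-distribʳ-* 2 Q k)) (sym (^-*-assoc 2 8 k)) ⟩
  (Q * 2 ^ k) ^ k * (2 * Q) ^ k * (2 ^ 8) ^ k
    ≡⟨ cong (_* (2 ^ 8) ^ k) (sym (^-distribʳ-* (Q * 2 ^ k) (2 * Q) k)) ⟩
  (Q * 2 ^ k * (2 * Q)) ^ k * (2 ^ 8) ^ k
    ≡⟨ sym (^-distribʳ-* (Q * 2 ^ k * (2 * Q)) (2 ^ 8) k) ⟩
  (Q * 2 ^ k * (2 * Q) * 2 ^ 8) ^ k
    ≡⟨ cong (_^ k) (rearrange Q (2 ^ k) (2 ^ 8)) ⟩
  (Q * Q * 2 ^ 8 * (2 * 2 ^ k)) ^ k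
    ≤⟨ ^-monoˡ-≤ k (*-monoˡ-≤ (2 * 2 ^ k) Q²≤) ⟩
  (2 ^ k * 2 ^ suc k) ^ k
    ≡⟨ trans (cong (_^ k) (sym (^-distribˡ-+-* 2 k (suc k)))) (^-*-assoc 2 (k + suc k) k) ⟩
  2 ^ ((k + suc k) * k)
    <⟨ ^-monoʳ-< 2 (s≤s (s≤s z≤n)) exponent ⟩
  2 ^ (e + 8 * k)
    ≡⟨ ^-distribˡ-+-* 2 e (8 * k) ⟩
  2 ^ e * 2 ^ (8 * k) ∎)
  where
  open ≤-Reasoning
  rearrange : ∀ Q p z → Q * p * (2 * Q) * z ≡ Q * Q * z * (2 * p)
  rearrange = solve 3 (λ Q p z → Q :* p :* (con 2 :* Q) :* z := Q :* Q :* z :* (con 2 :* p)) refl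
  exponent : (k + suc k) * k < e + 8 * k
  exponent = begin-strict
    (k + suc k) * k          ≡⟨ solve 1 (λ k → (k :+ (con 1 :+ k)) :* k := con 2 :* (k :* k) :+ k) refl k ⟩
    2 * (k * k) + k          ≡⟨ cong (λ z → 2 * (k * z) + k) k≡ ⟩
    2 * (k * (3 + q)) + k    ≡⟨ solve 2 (λ k q → con 2 :* (k :* (con 3 :+ q)) :+ k := con 2 :* (k :* q) :+ con 7 :* k) refl k q ⟩
    2 * (k * q) + 7 * k      ≡⟨ cong (_+ 7 * k) (sym e≡) ⟩
    suc e + 7 * k            ≡⟨ sym (+-suc e (7 * k)) ⟩
    e + suc (7 * k)          <⟨ +-monoʳ-< e (s≤s (≤-refl {suc (7 * k)})) ⟩
    e + (2 + 7 * k)          ≤⟨ +-monoʳ-≤ e (+-monoˡ-≤ (7 * k) (≤-trans (m≤m+n 2 (suc q)) (≤-reflexive (sym k≡)))) ⟩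
    e + (k + 7 * k)          ∎

tournament : ∀ q → 25 ≤ q →
  Σ (Matrix (blocks q * 2 ^ (3 + q))) λ h → Extends (beats h) (quotient {blocks q} (2 ^ (3 + q))) (3 + q)
tournament q 25≤q = Random.∃-extends {k = 2 + q} {w = 2 ^ k} {x} {X} {suc x * e} (quotient (2 ^ k)) (count-quotient (2 ^ k)) J≡
  (sizes (suc x) k q e refl K≡ e≡)
  (+-monoˡ-≤ (k * 2 ^ k) (≤-trans (n<2^n (2 + q)) (≤-reflexive (sym J≡))))
  (few (tasks<2^ (blocks q) k q e (blocks²≤ (≤⇒≤′ 25≤q)) refl e≡))
  where
  k x X e : ℕ
  k = 3 + q
  x = pred (2 ^ (2 + q))
  -- Write J = `suc x` = 2^(k-1). At most k + k 2^k vertices are excluded; rounding the first k up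
  -- to J in `X` leaves exactly J e of the c vertices, the exponent that `*x^<` requires.
  e = pred (2 * (k * q))
  X = suc x + k * 2 ^ k
  J≡ : suc x ≡ 2 ^ (2 + q)
  J≡ = suc-pred (2 ^ (2 + q)) {{m^n≢0 2 (2 + q)}}
  K≡ : 2 ^ k ≡ 2 * suc x
  K≡ = cong (2 *_) (sym J≡)
  q≢0 : NonZero q
  q≢0 = >-nonZero (≤-trans (s≤s z≤n) 25≤q)
  x≢0 : NonZero x
  x≢0 = >-nonZero (s≤s⁻¹ (≤-trans (^-monoʳ-≤ 2 (m≤m+n 1 (suc q))) (≤-reflexive (sym J≡))))
  e≡ : suc e ≡ 2 * (k * q)
  e≡ = suc-pred (2 * (k * q)) {{m*n≢0 2 (k * q) {{nonZero}} {{m*n≢0 k q {{nonZero}} {{q≢0}}}}}}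
  sizes : ∀ J k q e → k ≡ 3 + q → 2 ^ k ≡ 2 * J → suc e ≡ 2 * (k * q) →
    J + k * 2 ^ k + J * e ≡ (1 + q) * k * 2 ^ k
  sizes J k q e k≡ K≡ e≡ = begin
    J + k * 2 ^ k + J * e       ≡⟨ cong (λ z → J + k * z + J * e) K≡ ⟩
    J + k * (2 * J) + J * e     ≡⟨ solve 3 (λ J k e → J :+ k :* (con 2 :* J) :+ J :* e := k :* (con 2 :* J) :+ J :* (con 1 :+ e)) refl J k e ⟩
    k * (2 * J) + J * suc e     ≡⟨ cong (λ z → k * (2 * J) + J * z) e≡ ⟩
    k * (2 * J) + J * (2 * (k * q)) ≡⟨ solve 3 (λ J k q → k :* (con 2 :* J) :+ J :* (con 2 :* (k :* q)) := (con 1 :+ q) :* k :* (con 2 :* J)) refl J k q ⟩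
    (1 + q) * k * (2 * J)       ≡⟨ cong ((1 + q) * k *_) (sym K≡) ⟩
    (1 + q) * k * 2 ^ k         ∎
    where open ≡-Reasoning
  few : ∀ {n} → n < 2 ^ e → n * ((2 ^ k) ^ X * (2 * x) ^ (suc x * e)) < (2 ^ k) ^ (blocks q * 2 ^ k)
  few {n} n<2^e = begin-strict
    n * ((2 ^ k) ^ X * (2 * x) ^ Y)         ≡⟨ cong (λ z → n * ((2 ^ k) ^ X * z)) (^-distribʳ-* 2 x Y) ⟩
    n * ((2 ^ k) ^ X * (2 ^ Y * x ^ Y))     ≡⟨ regroup n ((2 ^ k) ^ X) (2 ^ Y) (x ^ Y) ⟩
    (2 ^ k) ^ X * (2 ^ Y * (n * x ^ Y))     <⟨ *-monoʳ-< ((2 ^ k) ^ X) {{m^n≢0 (2 ^ k) X {{m^n≢0 2 k}}}}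
                                                 (*-monoʳ-< (2 ^ Y) {{m^n≢0 2 Y}} (*x^< x {{x≢0}} n e n<2^e)) ⟩
    (2 ^ k) ^ X * (2 ^ Y * suc x ^ Y)       ≡⟨ cong ((2 ^ k) ^ X *_) (sym (^-distribʳ-* 2 (suc x) Y)) ⟩
    (2 ^ k) ^ X * (2 * suc x) ^ Y           ≡⟨ cong (λ z → (2 ^ k) ^ X * z ^ Y) (sym K≡) ⟩
    (2 ^ k) ^ X * (2 ^ k) ^ Y               ≡⟨ sym (^-distribˡ-+-* (2 ^ k) X Y) ⟩
    (2 ^ k) ^ (X + Y)                       ≡⟨ cong ((2 ^ k) ^_) (sizes (suc x) k q e refl K≡ e≡) ⟩
    (2 ^ k) ^ (blocks q * 2 ^ k)            ∎
    where
    open ≤-Reasoning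
    Y : ℕ
    Y = suc x * e
    regroup : ∀ a b c d → a * (b * (c * d)) ≡ b * (c * (a * d))
    regroup = solve 4 (λ a b c d → a :* (b :* (c :* d)) := b :* (c :* (a :* d))) refl

-- Extensions avoiding forbidden colours

-- Turns a list of at most `k` blocks into the `k`-tuple that `Extends` asks for; surplus places
-- repeat `x₀`, which merely forbids one more block.
pad : {X : Set} → X → List X → ∀ {k} → Fin k → X
pad x₀ []       i       = x₀
pad x₀ (x ∷ xs) zero    = x
pad x₀ (x ∷ xs) (suc i) = pad x₀ xs i

pad-onto : {X : Set} (x₀ : X) {xs : List X} → ∀ {k} → length xs ≤ k → ∀ {x} → x ∈ xs → ∃[ i ] pad x₀ xs {k} i ≡ x
pad-onto x₀ (s≤s le) (here refl) = zero , refl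
pad-onto x₀ (s≤s le) (there x∈) with pad-onto x₀ le x∈
... | i , eq = suc i , eq

length-filter-split : {X : Set} (key : X → Bool) (xs : List X) →
  length (filter (λ x → key x Bool.≟ true) xs) + length (filter (λ x → key x Bool.≟ false) xs) ≡ length xs
length-filter-split key [] = refl
length-filter-split key (x ∷ xs) with key x
... | true  = cong suc (length-filter-split key xs)
... | false = trans (+-suc _ _) (cong suc (length-filter-split key xs))

halve : {X : Set} (key : X → Bool) (xs : List X) →
  ∃[ b ] 2 * length (filter (λ x → key x Bool.≟ b) xs) ≤ length xs
halve key xs with ≤-total (length (filter (λ x → key x Bool.≟ true) xs)) (length (filter (λ x → key x Bool.≟ false) xs))
... | inj₁ t≤f = true , ≤-trans (+-monoʳ-≤ _ (≤-trans (≤-reflexive (+-identityʳ _)) t≤f)) (≤-reflexive (length-filter-split key xs))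
... | inj₂ f≤t = false , ≤-trans (+-mono-≤ f≤t (≤-reflexive (+-identityʳ _))) (≤-reflexive (length-filter-split key xs))

module Avoid {c Q k : ℕ} (T : Fin c → Fin c → Bool) (β : Fin c → Fin Q) (ext : Extends T β k) (k<c : k < c) where

  Extension : ∀ {j} → (Fin j → Fin c) → (Fin j → Bool) → List (Fin c) → Set
  Extension A p F = ∃[ a ] ∃[ s ] ((∀ i → a ≢ A i) × (∀ i → T a (A i) xor s ≡ p i) × a ∉ F)

  -- The first constraint determines the sign of a candidate a, hence also the value that a would
  -- take at one more colour d; prescribing the rarer of the two values at d halves the forbidden list.
  avoid : ∀ t {j} (A : Fin (suc j) → Fin c) (p : Fin (suc j) → Bool) (F : List (Fin c)) →
    (∀ i i′ → A i ≡ A i′ → i ≡ i′) → suc j + t ≡ k → length F ≤ 2 ^ t * k → Extension A p F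
  avoid zero {j} A p F inj eq le with trans (sym (+-identityʳ (suc j))) eq
  -- Now all k places carry constraints and `F` has at most k elements, so avoiding their blocks
  -- avoids them.
  ... | refl with ext A p (pad (β (A zero)) (map β F)) inj
  ... | a , s , a∉A , match , a∉F = a , s , a∉A , match , λ a∈F →
    let i , eq′ = pad-onto (β (A zero)) (≤-trans (≤-reflexive (length-map β F)) (≤-trans le (≤-reflexive (*-identityˡ (suc j))))) (∈-map⁺ β a∈F)
    in a∉F i (sym eq′)
  avoid (suc t) {j} A p F inj eq le = a , s , a∉ ∘ suc , match ∘ suc , a∉F
    where
    j<c : suc j < c
    j<c = ≤-<-trans (≤-trans (m≤m+n (suc j) (suc t)) (≤-reflexive eq)) k<c
    d : Fin c
    d = proj₁ (fresh A j<c)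
    d∉A : ∀ i → d ≢ A i
    d∉A = proj₂ (fresh A j<c)
    key : Fin c → Bool
    key f = T f d xor (T f (A zero) xor p zero)
    b : Bool
    b = proj₁ (halve key F)
    F′ : List (Fin c)
    F′ = filter (λ f → key f Bool.≟ b) F
    inj′ : ∀ i i′ → (d ∷ᶠ A) i ≡ (d ∷ᶠ A) i′ → i ≡ i′
    inj′ zero    zero     e = refl
    inj′ zero    (suc i′) e = ⊥-elim (d∉A i′ e)
    inj′ (suc i) zero     e = ⊥-elim (d∉A i (sym e))
    inj′ (suc i) (suc i′) e = cong suc (inj i i′ e)
    le′ : length F′ ≤ 2 ^ t * k
    le′ = *-cancelˡ-≤ 2 (≤-trans (proj₂ (halve key F)) (≤-trans le (≤-reflexive (*-assoc 2 (2 ^ t) k))))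
    rec : Extension (d ∷ᶠ A) (b ∷ᶠ p) F′
    rec = avoid t (d ∷ᶠ A) (b ∷ᶠ p) F′ inj′ (trans (sym (+-suc (suc j) t)) eq) le′
    a : Fin c
    a = proj₁ rec
    s : Bool
    s = proj₁ (proj₂ rec)
    a∉ : ∀ i → a ≢ (d ∷ᶠ A) i
    a∉ = proj₁ (proj₂ (proj₂ rec))
    match : ∀ i → T a ((d ∷ᶠ A) i) xor s ≡ (b ∷ᶠ p) i
    match = proj₁ (proj₂ (proj₂ (proj₂ rec)))
    a∉F : a ∉ F
    a∉F a∈F = proj₂ (proj₂ (proj₂ (proj₂ rec))) (∈-filter⁺ (λ f → key f Bool.≟ b) a∈F key≡b)
      where
      key≡b : key a ≡ b
      -- Entry `suc zero` of `d ∷ᶠ A` is `A zero`: its constraint yields the sign `s`, and the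
      -- constraint at `d` then forces the key of `a` to be `b`.
      key≡b = trans (cong (T a d xor_) (trans (cong (T a (A zero) xor_) (sym (match (suc zero)))) (xor-cancel′ (T a (A zero)) s)))
        (match zero)

  -- With j ≥ 1 constraints there is room for t = k - j more, and k + 1 - j ≤ 2^t. For j = 0 no
  -- constraint fixes the sign, so a dummy one at an arbitrary `d` comes first; that leaves t = k -
  -- 1, where `small` enters.
  extend-vertex : .{{_ : NonZero k}} → suc k ≤ 2 ^ pred k → ∀ {j} (A : Fin j → Fin c) (p : Fin j → Bool) (F : List (Fin c)) →
    (∀ i i′ → A i ≡ A i′ → i ≡ i′) → j ≤ k → length F ≤ (suc k ∸ j) * k → Extension A p F
  extend-vertex small {suc j} A p F inj j≤k le = avoid (k ∸ suc j) A p F inj (m+[n∸m]≡n j≤k)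
    (≤-trans le (*-monoˡ-≤ k (≤-trans (≤-reflexive (+-∸-assoc 1 j≤k)) (n<2^n (k ∸ suc j)))))
  extend-vertex small {zero} A p F inj j≤k le = a , s , (λ ()) , (λ ()) , a∉F
    where
    d : Fin c
    d = proj₁ (fresh {zero} {c} (λ ()) (≤-trans (s≤s z≤n) k<c))
    only : ∀ (i i′ : Fin 1) → d ≡ d → i ≡ i′
    only zero zero _ = refl
    rec : Extension (λ (_ : Fin 1) → d) (λ _ → true) F
    rec = avoid (pred k) (λ _ → d) (λ _ → true) F only (suc-pred k)
      (≤-trans le (*-monoˡ-≤ k small))
    a : Fin c
    a = proj₁ rec
    s : Bool
    s = proj₁ (proj₂ rec)
    a∉F : a ∉ F
    a∉F = proj₂ (proj₂ (proj₂ (proj₂ rec)))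

-- Lists of selected vertices and their sizes

select : ∀ {n} → (Fin n → Bool) → List (Fin n)
select {n} P = filter (λ u → P u Bool.≟ true) (allFin n)

length-select : ∀ {n} (P : Fin n → Bool) → length (select P) ≡ count P
length-select {n} P = go (allFin n)
  where
  go : ∀ xs → length (filter (λ u → P u Bool.≟ true) xs) ≡ ∑ xs (ind ∘ P)
  go [] = refl
  go (x ∷ xs) with P x
  ... | true  = cong suc (go xs)
  ... | false = go xs

∈-select⁺ : ∀ {n} (P : Fin n → Bool) {u} → P u ≡ true → u ∈ select P
∈-select⁺ P {u} Pu = ∈-filter⁺ (λ u → P u Bool.≟ true) (∈-allFin u) Pu

∈-select⁻ : ∀ {n} (P : Fin n → Bool) {u} → u ∈ select P → P u ≡ true
∈-select⁻ {n} P u∈ = proj₂ (∈-filter⁻ (λ u → P u Bool.≟ true) {xs = allFin n} u∈)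

lookup-injective : {X : Set} {xs : List X} → Unique xs → ∀ i j → List.lookup xs i ≡ List.lookup xs j → i ≡ j
lookup-injective (x∉ ∷ u) zero    zero    eq = refl
lookup-injective (x∉ ∷ u) zero    (suc j) eq = ⊥-elim (All.lookup x∉ (∈-lookup j) eq)
lookup-injective (x∉ ∷ u) (suc i) zero    eq = ⊥-elim (All.lookup x∉ (∈-lookup i) (sym eq))
lookup-injective (x∉ ∷ u) (suc i) (suc j) eq = cong suc (lookup-injective u i j eq)

length-concatMap≤ : {X Y : Set} (f : X → List Y) (m : ℕ) (xs : List X) → (∀ {x} → x ∈ xs → length (f x) ≤ m) →
  length (concatMap f xs) ≤ length xs * m
length-concatMap≤ f m []       le = z≤n
length-concatMap≤ f m (x ∷ xs) le = ≤-trans (≤-reflexive (length-++ (f x)))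
  (+-mono-≤ (le (here refl)) (length-concatMap≤ f m xs (le ∘ there)))

count-disjoint : ∀ {n} (P P′ R : Fin n → Bool) → (∀ i → ind (P i) + ind (P′ i) ≤ ind (R i)) → count P + count P′ ≤ count R
count-disjoint {n} P P′ R le = ≤-trans (≤-reflexive (sym (∑-+ (allFin n) (ind ∘ P) (ind ∘ P′)))) (∑-mono (allFin n) le)

count-positive : ∀ {n} (P : Fin n → Bool) {u} → P u ≡ true → 1 ≤ count P
count-positive P {u} Pu = ≤-trans (≤-reflexive (sym (cong ind Pu))) (∑-mem (ind ∘ P) u)

count-< : ∀ {n} (P R : Fin n → Bool) {v} → (∀ i → P i ≡ true → R i ≡ true) → P v ≡ false → R v ≡ true → count P < count R
count-< P R {v} P⊆R Pv Rv = ≤-trans (≤-reflexive (+-comm 1 (count P)))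
  (≤-trans (+-monoʳ-≤ (count P) (count-positive (_≡ᶠ v) {v} (≡ᶠ-refl v))) (count-disjoint P (_≡ᶠ v) R le))
  where
  le : ∀ i → ind (P i) + ind (i ≡ᶠ v) ≤ ind (R i)
  le i with i Fin.≟ v
  ... | yes refl = ≤-reflexive (trans (cong (λ b → ind b + 1) Pv) (cong ind (sym Rv)))
  ... | no _ = ≤-trans (≤-reflexive (+-identityʳ _)) (ind-mono (P i) (λ Pi → ≤-reflexive (cong ind (sym (P⊆R i Pi)))))

override : ∀ {n} {X : Set} → (Fin n → X) → Fin n → X → Fin n → X
override f v x u = if u ≡ᶠ v then x else f u

-- Colouring

∧-intro : ∀ {x y} → x ≡ true → y ≡ true → x ∧ y ≡ true
∧-intro refl refl = refl

∧-elim : ∀ x {y} → x ∧ y ≡ true → x ≡ true × y ≡ true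
∧-elim true eq = refl , eq

∨-introˡ : ∀ {x} y → x ≡ true → x ∨ y ≡ true
∨-introˡ y refl = refl

not-true⇒false : ∀ {x} → not x ≡ true → x ≡ false
not-true⇒false {false} eq = refl

add : ∀ {n} → (Fin n → Bool) → Fin n → Fin n → Bool
add V v u = V u ∨ (u ≡ᶠ v)

add-self : ∀ {n} (V : Fin n → Bool) v → add V v v ≡ true
add-self V v rewrite ≡ᶠ-refl v = Bool.∨-zeroʳ (V v)

add-other : ∀ {n} (V : Fin n → Bool) {v u} → u ≢ v → V u ≡ false → add V v u ≡ false
add-other V u≢v Vu rewrite Vu = ≡ᶠ-≢ u≢v

-- With `V` the set of uncoloured vertices, a walk from the root to a coloured vertex reveals a
-- coloured vertex that has an uncoloured neighbour.
walk-exit : ∀ {n} {G : Graph n} (V : Fin n → Bool) {u x} → Walk G u x → V u ≡ true → V x ≡ false →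
  ∃[ w ] ∃[ v ] (adj G w v ≡ true × V w ≡ true × V v ≡ false)
walk-exit V here Vu Vx = ⊥-elim (true≢false (trans (sym Vu) Vx))
walk-exit V (step {u} {v} uv walk) Vu Vx with V v in Vv
... | true  = walk-exit V walk Vv Vx
... | false = u , v , uv , Vu , Vv

pushArc-noOpp : ∀ {n} (D : OGraph n) S u v → pushArc D S u v ≡ true → pushArc D S v u ≡ false
pushArc-noOpp D S u v eq rewrite Bool.xor-comm (S v) (S u) with S u xor S v
... | true  = noOpp D v u eq
... | false = noOpp D u v eq

module Colour {n : ℕ} {G : Graph n} {D : OGraph n} (orient : IsOrientation G D)
  {c Q k : ℕ} .{{_ : NonZero k}} (small : suc k ≤ 2 ^ pred k) (k<c : k < c) (deg : ∀ u → degree G u ≤ suc k)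
  (T : Fin c → Fin c → Bool) (flip : ∀ a b → a ≢ b → T a b ≡ not (T b a))
  (β : Fin c → Fin Q) (ext : Extends T β k) where

  open Avoid T β ext k<c

  arc⇒adj : ∀ {u v} → arc D u v ≡ true → adj G u v ≡ true
  arc⇒adj {u} {v} uv = trans (orient u v) (∨-introˡ (arc D v u) uv)

  -- V is the set of vertices that are not yet coloured; the values of col and sgn on V are junk.
  record Colouring (V : Fin n → Bool) : Set where
    field
      col       : Fin n → Fin c
      sgn       : Fin n → Bool
      proper    : ∀ u v → V u ≡ false → V v ≡ false → arc D u v ≡ true →
                  col u ≢ col v × (T (col u) (col v) xor sgn v) xor sgn u ≡ true
      separated : ∀ z u v → V z ≡ true → V u ≡ false → V v ≡ false → adj G z u ≡ true → adj G z v ≡ true →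
                  col u ≡ col v → u ≡ v

  -- `χ` colours all vertices outside `V` except `v`. The uncoloured neighbour `w` takes one place
  -- in the neighbourhood of `v`, so at most k neighbours impose constraints.
  module Step (V : Fin n → Bool) (v w : Fin n) (Vv : V v ≡ false) (Vw : V w ≡ true) (vw : adj G v w ≡ true)
    (χ : Colouring (add V v)) where

    open Colouring χ

    done : Fin n → Bool
    done u = not (add V v u)

    ⇒done : ∀ {u} → u ≢ v → V u ≡ false → done u ≡ true
    ⇒done u≢v Vu = cong not (add-other V u≢v Vu)

    isEarlier isLater : Fin n → Bool
    isEarlier u = adj G v u ∧ done u
    isLater z = adj G v z ∧ V z

    isNear : Fin n → Fin n → Bool
    isNear z u = adj G z u ∧ done u

    neighbours : Fin n → List (Fin n)
    neighbours z = select (isNear z)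

    earlier later : List (Fin n)
    earlier = select isEarlier
    later = select isLater

    -- Colours at distance two from `v` through an uncoloured vertex; avoiding them keeps
    -- `separated` true once `v` is coloured.
    forbidden : List (Fin c)
    forbidden = concatMap (map col ∘ neighbours) later

    degree-split : count isEarlier + count isLater ≤ suc k
    degree-split = ≤-trans (count-disjoint isEarlier isLater (adj G v) le) (deg v)
      where
      le : ∀ u → ind (isEarlier u) + ind (isLater u) ≤ ind (adj G v u)
      le u with adj G v u | V u | u ≡ᶠ v
      ... | true  | true  | _     = ≤-refl
      ... | true  | false | true  = z≤n
      ... | true  | false | false = ≤-refl
      ... | false | _     | _     = z≤n

    earlier≤k : length earlier ≤ k
    earlier≤k = s≤s⁻¹ (≤-trans (≤-reflexive (trans (cong suc (length-select isEarlier)) (+-comm 1 _)))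
      (≤-trans (+-monoʳ-≤ (count isEarlier) (count-positive isLater (∧-intro vw Vw))) degree-split))

    -- `v` itself is a neighbour of `z` that is not yet `done`, which takes one of at most k + 1
    -- places.
    neighbours≤k : ∀ {z} → z ∈ later → length (map col (neighbours z)) ≤ k
    neighbours≤k {z} z∈ = ≤-trans (≤-reflexive (trans (length-map col (neighbours z)) (length-select (isNear z))))
      (s≤s⁻¹ (≤-trans (count-< (isNear z) (adj G z) {v} (λ u eq → proj₁ (∧-elim (adj G z u) eq))
        (trans (cong (adj G z v ∧_) (cong not (add-self V v))) (Bool.∧-zeroʳ _))
        (trans (adj-sym G z v) (proj₁ (∧-elim (adj G v z) (∈-select⁻ isLater z∈))))) (deg z)))

    length-forbidden : length forbidden ≤ (suc k ∸ length earlier) * k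
    length-forbidden = ≤-trans (length-concatMap≤ (map col ∘ neighbours) k later neighbours≤k)
      (*-monoˡ-≤ k (≤-trans (≤-reflexive (length-select isLater))
        (m+n≤o⇒n≤o∸m (length earlier) (≤-trans (≤-reflexive (cong (_+ count isLater) (length-select isEarlier))) degree-split))))
      where
      m+n≤o⇒n≤o∸m : ∀ m {n o} → m + n ≤ o → n ≤ o ∸ m
      m+n≤o⇒n≤o∸m m {n} le = m+n≤o⇒m≤o∸n n (≤-trans (≤-reflexive (+-comm n m)) le)

    colours : Fin (length earlier) → Fin c
    colours i = col (List.lookup earlier i)

    -- The condition `proper` on the edge between `v` and `u`, solved for `T a (col u) xor s`. By
    -- antisymmetry of `T`, one formula serves both directions of the arc.
    wanted : Fin n → Bool
    wanted u = sgn u xor arc D v u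

    earlier-lookup : ∀ i → adj G v (List.lookup earlier i) ≡ true × done (List.lookup earlier i) ≡ true
    earlier-lookup i = ∧-elim (adj G v (List.lookup earlier i)) (∈-select⁻ isEarlier (∈-lookup i))

    -- For `χ` the vertex `v` is still uncoloured, so `separated` applies with `v` as the common
    -- neighbour.
    colours-injective : ∀ i j → colours i ≡ colours j → i ≡ j
    colours-injective i j eq = lookup-injective (filter⁺ _ (allFin⁺ n)) i j
      (separated v _ _ (add-self V v) (not-true⇒false (proj₂ (earlier-lookup i))) (not-true⇒false (proj₂ (earlier-lookup j)))
        (proj₁ (earlier-lookup i)) (proj₁ (earlier-lookup j)) eq)

    extension : Extension colours (wanted ∘ List.lookup earlier) forbidden
    extension = extend-vertex small colours _ forbidden colours-injective earlier≤k length-forbidden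

    a : Fin c
    a = proj₁ extension

    s : Bool
    s = proj₁ (proj₂ extension)

    at-earlier : ∀ {u} → adj G v u ≡ true → done u ≡ true → a ≢ col u × T a (col u) xor s ≡ wanted u
    at-earlier {u} vu du = subst (λ x → a ≢ col x × T a (col x) xor s ≡ wanted x) (sym (lookup-index u∈))
      (proj₁ (proj₂ (proj₂ extension)) (Any.index u∈) , proj₁ (proj₂ (proj₂ (proj₂ extension))) (Any.index u∈))
      where
      u∈ : u ∈ earlier
      u∈ = ∈-select⁺ isEarlier (∧-intro vu du)

    avoids : ∀ {z u} → adj G v z ≡ true → V z ≡ true → adj G z u ≡ true → done u ≡ true → a ≢ col u
    avoids {z} {u} vz Vz zu du a≡ = proj₂ (proj₂ (proj₂ (proj₂ extension)))
      (∈-concatMap⁺ (map col ∘ neighbours) (lose (∈-select⁺ isLater (∧-intro vz Vz))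
        (subst (_∈ map col (neighbours z)) (sym a≡) (∈-map⁺ col (∈-select⁺ (isNear z) (∧-intro zu du))))))

    col′ : Fin n → Fin c
    col′ = override col v a

    sgn′ : Fin n → Bool
    sgn′ = override sgn v s

    out : ∀ {u} → arc D v u ≡ true → u ≢ v → V u ≡ false → a ≢ col u × (T a (col u) xor sgn u) xor s ≡ true
    out {u} vu u≢v Vu with at-earlier (arc⇒adj vu) (⇒done u≢v Vu)
    ... | a≢ , match = a≢ , by-cases (T a (col u)) (sgn u) s (trans match (cong (sgn u xor_) vu))
      where
      by-cases : ∀ t x s → t xor s ≡ x xor true → (t xor x) xor s ≡ true
      by-cases true  true  true  eq = refl
      by-cases true  false false eq = refl
      by-cases false true  false eq = refl
      by-cases false false true  eq = refl

    into : ∀ {u} → arc D u v ≡ true → u ≢ v → V u ≡ false → col u ≢ a × (T (col u) a xor s) xor sgn u ≡ true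
    into {u} uv u≢v Vu with at-earlier (trans (adj-sym G v u) (arc⇒adj uv)) (⇒done u≢v Vu)
    ... | a≢ , match = a≢ ∘ sym , trans (cong (λ t → (t xor s) xor sgn u) (flip (col u) a (a≢ ∘ sym)))
        (by-cases (T a (col u)) (sgn u) s (trans match (trans (cong (sgn u xor_) (noOpp D u v uv)) (Bool.xor-identityʳ _))))
      where
      by-cases : ∀ t x s → t xor s ≡ x → (not t xor s) xor x ≡ true
      by-cases true  x true  refl = refl
      by-cases true  x false refl = refl
      by-cases false x true  refl = refl
      by-cases false x false refl = refl

    extended : Colouring V
    extended = record { col = col′ ; sgn = sgn′ ; proper = proper′ ; separated = separated′ }
      where
      proper′ : ∀ u u′ → V u ≡ false → V u′ ≡ false → arc D u u′ ≡ true →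
        col′ u ≢ col′ u′ × (T (col′ u) (col′ u′) xor sgn′ u′) xor sgn′ u ≡ true
      proper′ u u′ Vu Vu′ uu′ with u Fin.≟ v | u′ Fin.≟ v
      ... | yes refl | yes refl = ⊥-elim (true≢false (trans (sym uu′) (loopless D u)))
      ... | yes refl | no u′≢v  = out uu′ u′≢v Vu′
      ... | no u≢v   | yes refl = into uu′ u≢v Vu
      ... | no u≢v   | no u′≢v  = proper u u′ (add-other V u≢v Vu) (add-other V u′≢v Vu′) uu′
      separated′ : ∀ z u u′ → V z ≡ true → V u ≡ false → V u′ ≡ false → adj G z u ≡ true → adj G z u′ ≡ true →
        col′ u ≡ col′ u′ → u ≡ u′
      separated′ z u u′ Vz Vu Vu′ zu zu′ eq with u Fin.≟ v | u′ Fin.≟ v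
      ... | yes refl | yes refl = refl
      ... | yes refl | no u′≢v  = ⊥-elim (avoids (trans (adj-sym G u z) zu) Vz zu′ (⇒done u′≢v Vu′) eq)
      ... | no u≢v   | yes refl = ⊥-elim (avoids (trans (adj-sym G u′ z) zu′) Vz zu (⇒done u≢v Vu) (sym eq))
      ... | no u≢v   | no u′≢v  = separated z u u′ (∨-introˡ _ Vz) (add-other V u≢v Vu) (add-other V u′≢v Vu′) zu zu′ eq

  -- The recursion peels off the vertex coloured last: some coloured `v` with an uncoloured
  -- neighbour is put back into `V`, the rest is coloured first, and then `Step` treats `v`. `m`
  -- bounds the number of coloured vertices; the root `r` stays in `V` throughout.
  colour-all : Connected G → ∀ m (V : Fin n → Bool) r → V r ≡ true → count (not ∘ V) ≤ m → Colouring V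
  colour-all conn m V r Vr le with Fin.any? (λ x → V x Bool.≟ false)
  ... | no none = record
    { col = λ _ → proj₁ (fresh {zero} {c} (λ ()) (≤-trans (s≤s z≤n) k<c))
    ; sgn = λ _ → false
    ; proper = λ u v Vu → ⊥-elim (none (u , Vu))
    ; separated = λ z u v _ Vu → ⊥-elim (none (u , Vu)) }
  colour-all conn zero V r Vr le | yes (x , Vx) =
    ⊥-elim (1+n≰n (≤-trans (count-positive (not ∘ V) {x} (cong not Vx)) le))
  colour-all conn (suc m) V r Vr le | yes (x , Vx) with walk-exit V (conn r x) Vr Vx
  ... | w , v , wv , Vw , Vv = Step.extended V v w Vv Vw (trans (adj-sym G v w) wv)
    (colour-all conn m (add V v) r (∨-introˡ _ Vr) (s≤s⁻¹ (≤-trans fewer le)))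
    where
    fewer : count (not ∘ add V v) < count (not ∘ V)
    fewer = count-< (not ∘ add V v) (not ∘ V) {v} (λ u eq → smaller (V u) eq) (cong not (add-self V v)) (cong not Vv)
      where
      smaller : ∀ x {y} → not (x ∨ y) ≡ true → not x ≡ true
      smaller false eq = refl

  module Target (conn : Connected G) (r : Fin n) where

    open Colouring (colour-all conn _ (_≡ᶠ r) r (≡ᶠ-refl r) ≤-refl)

    pushed : Fin n → Fin n → Bool
    pushed = pushArc D sgn

    pushed⇒adj : ∀ {u v} → pushed u v ≡ true → adj G u v ≡ true
    pushed⇒adj {u} {v} eq with sgn u xor sgn v
    ... | true  = trans (adj-sym G u v) (arc⇒adj eq)
    ... | false = arc⇒adj eq

    pushed-irrefl : ∀ {u v} → pushed u v ≡ true → u ≢ v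
    pushed-irrefl {u} eq refl = true≢false (trans (sym (pushed⇒adj eq)) (irrefl G u))

    fromRoot? : ∀ a → Dec (∃[ u ] (pushed r u ≡ true × col u ≡ a))
    fromRoot? a = Fin.any? (λ u → (pushed r u Bool.≟ true) ×-dec (col u Fin.≟ a))

    toRoot? : ∀ a → Dec (∃[ u ] (pushed u r ≡ true × col u ≡ a))
    toRoot? a = Fin.any? (λ u → (pushed u r Bool.≟ true) ×-dec (col u Fin.≟ a))

    -- The root is uncoloured, so `separated` gives its neighbours distinct colours. A colour
    -- occurring in both directions would come from a single vertex joined to the root by opposite
    -- arcs.
    root-consistent : ∀ {a} → ∃[ u ] (pushed r u ≡ true × col u ≡ a) → ∃[ u ] (pushed u r ≡ true × col u ≡ a) → ⊥
    root-consistent (u , ru , cu) (u′ , u′r , cu′)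
      with separated r u u′ (≡ᶠ-refl r) (≡ᶠ-≢ (pushed-irrefl ru ∘ sym)) (≡ᶠ-≢ (pushed-irrefl u′r))
             (pushed⇒adj ru) (trans (adj-sym G r u′) (pushed⇒adj u′r)) (trans cu (sym cu′))
    ... | refl = true≢false (trans (sym u′r) (pushArc-noOpp D sgn r u ru))

    -- Colour `zero` is reserved for the root and copies its arcs after pushing. The diagonal is
    -- cleared since `flip` says nothing about `T a a`.
    tArc : Fin (suc c) → Fin (suc c) → Bool
    tArc zero    zero    = false
    tArc zero    (suc a) = does (fromRoot? a)
    tArc (suc a) zero    = does (toRoot? a)
    tArc (suc a) (suc b) = if a ≡ᶠ b then false else T a b

    target : OGraph (suc c)
    target = record { arc = tArc ; loopless = loopless′ ; noOpp = noOpp′ }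
      where
      loopless′ : ∀ a → tArc a a ≡ false
      loopless′ zero = refl
      loopless′ (suc a) rewrite ≡ᶠ-refl a = refl
      noOpp′ : ∀ a b → tArc a b ≡ true → tArc b a ≡ false
      noOpp′ zero    (suc b) eq = dec-false (toRoot? b) (root-consistent (does-sound (fromRoot? b) eq))
      noOpp′ (suc a) zero    eq = dec-false (fromRoot? a) (λ p → root-consistent p (does-sound (toRoot? a) eq))
      noOpp′ (suc a) (suc b) eq with a Fin.≟ b
      ... | no a≢b rewrite ≡ᶠ-≢ (a≢b ∘ sym) = trans (flip b a (a≢b ∘ sym)) (cong not eq)

    φ : Fin n → Fin (suc c)
    φ = override (suc ∘ col) r zero

    off : ∀ {a b} → a ≢ b → T a b ≡ true → tArc (suc a) (suc b) ≡ true
    off a≢b t rewrite ≡ᶠ-≢ a≢b = t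

    tArc-inner : ∀ {u v} → u ≢ r → v ≢ r → pushed u v ≡ true → tArc (suc (col u)) (suc (col v)) ≡ true
    tArc-inner {u} {v} u≢r v≢r uv with sgn u xor sgn v in e
    -- Exactly one end is pushed, so the arc of `D` runs from `v` to `u`, and `flip` reverses the
    -- conclusion of `proper`.
    ... | true = let c≢ , t = proper v u (≡ᶠ-≢ v≢r) (≡ᶠ-≢ u≢r) uv in
        off (c≢ ∘ sym) (trans (flip (col u) (col v) (c≢ ∘ sym)) (by-cases _ (sgn u) (sgn v) e t))
      where
      by-cases : ∀ t x y → x xor y ≡ true → (t xor x) xor y ≡ true → not t ≡ true
      by-cases false x y _ _ = refl
      by-cases true true true () _
      by-cases true true false _ ()
      by-cases true false true _ ()
      by-cases true false false () _
    ... | false = let c≢ , t = proper u v (≡ᶠ-≢ u≢r) (≡ᶠ-≢ v≢r) uv in off c≢ (by-cases _ (sgn u) (sgn v) e t)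
      where
      by-cases : ∀ t x y → x xor y ≡ false → (t xor y) xor x ≡ true → t ≡ true
      by-cases true  x     y     _  _ = refl
      by-cases false true  true  _  ()
      by-cases false false false _  ()

    hom : IsHom pushed target φ
    hom u v uv with u Fin.≟ r | v Fin.≟ r
    ... | yes refl | yes refl = ⊥-elim (pushed-irrefl uv refl)
    ... | yes refl | no _     = dec-true (fromRoot? (col v)) (v , uv , refl)
    ... | no _     | yes refl = dec-true (toRoot? (col u)) (u , uv , refl)
    ... | no u≢r   | no v≢r   = tArc-inner u≢r v≢r uv

    colourable : PushColourable D (suc c)
    colourable = suc c , ≤-refl , target , φ , sgn , hom

-- Counting orientations of a bipartite band

walk-trans : ∀ {n} {G : Graph n} {u v w} → Walk G u v → Walk G v w → Walk G u w
walk-trans here        q = q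
walk-trans (step uv p) q = step uv (walk-trans p q)

walk-sym : ∀ {n} {G : Graph n} {u v} → Walk G u v → Walk G v u
walk-sym here = here
walk-sym {G = G} (step {u} {v} uv p) = walk-trans (walk-sym p) (step (trans (adj-sym G v u) uv) here)

-- Indexed by ℕ so that `bit` can read at an offset without a proof that it is in range.
nth : ∀ {n} → Vec Bool n → ℕ → Bool
nth []      m       = false
nth (x ∷ v) zero    = x
nth (x ∷ v) (suc m) = nth v m

nth-toℕ : ∀ {n} (v : Vec Bool n) i → nth v (toℕ i) ≡ lookup v i
nth-toℕ (x ∷ v) zero    = refl
nth-toℕ (x ∷ v) (suc i) = nth-toℕ v i

clip : ∀ k → ℕ → Fin (suc k)
clip k m = fromℕ< (s≤s (m⊓n≤n m k))

toℕ-clip : ∀ k {m} → m ≤ k → toℕ (clip k m) ≡ m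
toℕ-clip k {m} m≤k = trans (Fin.toℕ-fromℕ< _) (m≤n⇒m⊓n≡m m≤k)

splitAt-injective : ∀ m {n} (u v : Fin (m + n)) → splitAt m u ≡ splitAt m v → u ≡ v
splitAt-injective m {n} u v eq = trans (sym (Fin.join-splitAt m n u)) (trans (cong (join m n) eq) (Fin.join-splitAt m n v))

-- Left vertex i is joined to the right vertices i, ..., i + k. The k extra right vertices give
-- every left vertex degree exactly k + 1, so the edges are indexed by pairs (i, t) with t ≤ k.
module Band (k N : ℕ) .{{_ : NonZero k}} .{{_ : NonZero N}} where

  n : ℕ
  n = N + (N + k)

  Side : Set
  Side = Fin N ⊎ Fin (N + k)

  edge? : (i : Fin N) (j : Fin (N + k)) → Dec (toℕ i ≤ toℕ j × toℕ j ≤ toℕ i + k)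
  edge? i j = (toℕ i ≤? toℕ j) ×-dec (toℕ j ≤? toℕ i + k)

  edge : Fin N → Fin (N + k) → Bool
  edge i j = does (edge? i j)

  adjS : Side → Side → Bool
  adjS (inj₁ i) (inj₂ j) = edge i j
  adjS (inj₂ j) (inj₁ i) = edge i j
  adjS (inj₁ _) (inj₁ _) = false
  adjS (inj₂ _) (inj₂ _) = false

  adjS-sym : ∀ s t → adjS s t ≡ adjS t s
  adjS-sym (inj₁ _) (inj₁ _) = refl
  adjS-sym (inj₁ _) (inj₂ _) = refl
  adjS-sym (inj₂ _) (inj₁ _) = refl
  adjS-sym (inj₂ _) (inj₂ _) = refl

  adjS-irrefl : ∀ s → adjS s s ≡ false
  adjS-irrefl (inj₁ _) = refl
  adjS-irrefl (inj₂ _) = refl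

  G : Graph n
  G = record
    { adj = λ u v → adjS (splitAt N u) (splitAt N v)
    ; sym = λ u v → adjS-sym (splitAt N u) (splitAt N v)
    ; irrefl = λ u → adjS-irrefl (splitAt N u) }

  left : Fin N → Fin n
  left i = i ↑ˡ (N + k)

  right : Fin (N + k) → Fin n
  right j = N ↑ʳ j

  adj-left-right : ∀ i j → toℕ i ≤ toℕ j → toℕ j ≤ toℕ i + k → adj G (left i) (right j) ≡ true
  adj-left-right i j i≤j j≤i+k
    rewrite Fin.splitAt-↑ˡ N i (N + k) | Fin.splitAt-↑ʳ N (N + k) j = dec-true (edge? i j) (i≤j , j≤i+k)

  -- The offset of an edge, read from either end. With one end fixed it determines the other, which
  -- bounds all degrees by k + 1.
  gap : Side → Side → ℕ
  gap (inj₁ i) (inj₂ j) = toℕ j ∸ toℕ i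
  gap (inj₂ j) (inj₁ i) = toℕ j ∸ toℕ i
  gap _        _        = 0

  edge⇒ : ∀ i j → edge i j ≡ true → toℕ i ≤ toℕ j × toℕ j ≤ toℕ i + k
  edge⇒ i j = does-sound (edge? i j)

  edge⇒gap≤k : ∀ i j → edge i j ≡ true → toℕ j ∸ toℕ i ≤ k
  edge⇒gap≤k i j e = m≤n+o⇒m∸n≤o (toℕ j) (toℕ i) (proj₂ (edge⇒ i j e))

  gap≤k : ∀ s t → adjS s t ≡ true → gap s t ≤ k
  gap≤k (inj₁ i) (inj₂ j) e = edge⇒gap≤k i j e
  gap≤k (inj₂ j) (inj₁ i) e = edge⇒gap≤k i j e

  gap-injective : ∀ s t t′ → adjS s t ≡ true → adjS s t′ ≡ true → gap s t ≡ gap s t′ → t ≡ t′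
  gap-injective (inj₁ i) (inj₂ j) (inj₂ j′) e e′ eq =
    cong inj₂ (Fin.toℕ-injective (∸-cancelʳ-≡ (proj₁ (edge⇒ i j e)) (proj₁ (edge⇒ i j′ e′)) eq))
  gap-injective (inj₂ j) (inj₁ i) (inj₁ i′) e e′ eq =
    cong inj₁ (Fin.toℕ-injective (∸-cancelˡ-≡ (proj₁ (edge⇒ i j e)) (proj₁ (edge⇒ i′ j e′)) eq))

  degree≤ : ∀ u → degree G u ≤ suc k
  degree≤ u = count-≤-injection (adj G u) (λ v → clip k (gap (splitAt N u) (splitAt N v))) λ v v′ e e′ eq →
    splitAt-injective N v v′ (gap-injective (splitAt N u) _ _ e e′
      (trans (sym (toℕ-clip k (gap≤k (splitAt N u) _ e))) (trans (cong toℕ eq) (toℕ-clip k (gap≤k (splitAt N u) _ e′)))))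

  nb< : (i : Fin N) (t : Fin (suc k)) → toℕ i + toℕ t < N + k
  nb< i t = +-mono-<-≤ (Fin.toℕ<n i) (s≤s⁻¹ (Fin.toℕ<n t))

  nb : Fin N → Fin (suc k) → Fin (N + k)
  nb i t = fromℕ< (nb< i t)

  toℕ-nb : ∀ i t → toℕ (nb i t) ≡ toℕ i + toℕ t
  toℕ-nb i t = Fin.toℕ-fromℕ< (nb< i t)

  edge-nb : ∀ i t → edge i (nb i t) ≡ true
  edge-nb i t = dec-true (edge? i (nb i t)) (subst (λ z → toℕ i ≤ z × z ≤ toℕ i + k) (sym (toℕ-nb i t))
    (m≤m+n _ _ , +-monoʳ-≤ (toℕ i) (s≤s⁻¹ (Fin.toℕ<n t))))

  adj-nb : ∀ i t → adj G (left i) (right (nb i t)) ≡ true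
  adj-nb i t rewrite Fin.splitAt-↑ˡ N i (N + k) | Fin.splitAt-↑ʳ N (N + k) (nb i t) = edge-nb i t

  degree-left : ∀ i → degree G (left i) ≡ suc k
  degree-left i = ≤-antisym (degree≤ (left i)) (count-≥-injection (adj G (left i)) (right ∘ nb i)
    (λ t t′ eq → Fin.toℕ-injective (+-cancelˡ-≡ (toℕ i) _ _
      (trans (sym (toℕ-nb i t)) (trans (cong toℕ (Fin.↑ʳ-injective N _ _ eq)) (toℕ-nb i t′)))))
    (adj-nb i))

  origin : Fin N
  origin = fromℕ< (>-nonZero⁻¹ N)

  -- Left vertices m + 1 and m share the right neighbour m + 1, since k ≥ 1.
  left-to-origin : ∀ m (m<N : m < N) → Walk G (left (fromℕ< m<N)) (left origin)
  left-to-origin zero    m<N = here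
  left-to-origin (suc m) m<N = step (adj-left-right i j (≤-reflexive (trans i≡ (sym j≡))) (≤-trans (≤-reflexive (trans j≡ (sym i≡))) (m≤m+n _ k)))
    (step (trans (adj-sym G (right j) (left i′)) (adj-left-right i′ j
        (≤-trans (≤-reflexive i′≡) (≤-trans (n≤1+n m) (≤-reflexive (sym j≡))))
        (≤-trans (≤-reflexive (trans j≡ (+-comm 1 m))) (+-mono-≤ (≤-reflexive (sym i′≡)) (>-nonZero⁻¹ k)))))
      (left-to-origin m (<-trans (n<1+n m) m<N)))
    where
    i i′ : Fin N
    i = fromℕ< m<N
    i′ = fromℕ< (<-trans (n<1+n m) m<N)
    i≡ : toℕ i ≡ suc m
    i≡ = Fin.toℕ-fromℕ< m<N
    i′≡ : toℕ i′ ≡ m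
    i′≡ = Fin.toℕ-fromℕ< (<-trans (n<1+n m) m<N)
    m<N+k : suc m < N + k
    m<N+k = ≤-trans m<N (m≤m+n N k)
    j : Fin (N + k)
    j = fromℕ< m<N+k
    j≡ : toℕ j ≡ suc m
    j≡ = Fin.toℕ-fromℕ< m<N+k

  from-left : ∀ i → Walk G (left i) (left origin)
  from-left i = subst (λ i → Walk G (left i) (left origin)) (Fin.fromℕ<-toℕ i (Fin.toℕ<n i)) (left-to-origin (toℕ i) (Fin.toℕ<n i))

  -- Right vertex j is joined to left vertex j if j < N, and to the last left vertex otherwise.
  from-right : ∀ j → Walk G (right j) (left origin)
  from-right j with toℕ j ℕ.<? N
  ... | yes j<N = step (trans (adj-sym G (right j) (left i)) (adj-left-right i j
      (≤-reflexive i≡) (≤-trans (≤-reflexive (sym i≡)) (m≤m+n _ k)))) (from-left i)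
    where
    i : Fin N
    i = fromℕ< j<N
    i≡ : toℕ i ≡ toℕ j
    i≡ = Fin.toℕ-fromℕ< j<N
  ... | no j≮N = step (trans (adj-sym G (right j) (left i)) (adj-left-right i j
      (≤-trans (≤-reflexive i≡) (≤-trans pred[n]≤n (≮⇒≥ j≮N)))
      (s≤s⁻¹ (≤-trans (Fin.toℕ<n j) (≤-reflexive (cong (_+ k) (sym (trans (cong suc i≡) (suc-pred N))))))))) (from-left i)
    where
    last<N : pred N < N
    last<N = ≤-reflexive (suc-pred N)
    i : Fin N
    i = fromℕ< last<N
    i≡ : toℕ i ≡ pred N
    i≡ = Fin.toℕ-fromℕ< last<N

  to-origin : ∀ u → Walk G u (left origin)
  to-origin u with splitAt N u in eq
  ... | inj₁ i = subst (λ u → Walk G u (left origin)) (Fin.splitAt⁻¹-↑ˡ eq) (from-left i)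
  ... | inj₂ j = subst (λ u → Walk G u (left origin)) (Fin.splitAt⁻¹-↑ʳ eq) (from-right j)

  connected : Connected G
  connected u v = walk-trans (to-origin u) (walk-sym (to-origin v))

  maxDegree : MaxDegree G (suc k)
  maxDegree = degree≤ , left origin , degree-left origin

  Bits : Set
  Bits = Vec (Vec Bool (suc k)) N

  bit : Bits → Fin N → Fin (N + k) → Bool
  bit b i j = nth (lookup b i) (toℕ j ∸ toℕ i)

  bit-nb : ∀ b i t → bit b i (nb i t) ≡ lookup (lookup b i) t
  bit-nb b i t = trans (cong (nth (lookup b i)) (trans (cong (_∸ toℕ i) (toℕ-nb i t)) (m+n∸m≡n (toℕ i) (toℕ t))))
    (nth-toℕ (lookup b i) t)

  arcS : Bits → Side → Side → Bool
  arcS b (inj₁ i) (inj₂ j) = edge i j ∧ bit b i j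
  arcS b (inj₂ j) (inj₁ i) = edge i j ∧ not (bit b i j)
  arcS b (inj₁ _) (inj₁ _) = false
  arcS b (inj₂ _) (inj₂ _) = false

  arcS-loopless : ∀ b s → arcS b s s ≡ false
  arcS-loopless b (inj₁ _) = refl
  arcS-loopless b (inj₂ _) = refl

  arcS-noOpp : ∀ b s t → arcS b s t ≡ true → arcS b t s ≡ false
  arcS-noOpp b (inj₁ i) (inj₂ j) eq with edge i j | bit b i j
  ... | true | true = refl
  arcS-noOpp b (inj₂ j) (inj₁ i) eq with edge i j | bit b i j
  ... | true | false = refl

  arcS-orients : ∀ b s t → adjS s t ≡ (arcS b s t ∨ arcS b t s)
  arcS-orients b (inj₁ i) (inj₂ j) with edge i j | bit b i j
  ... | true  | true  = refl
  ... | true  | false = refl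
  ... | false | _     = refl
  arcS-orients b (inj₂ j) (inj₁ i) with edge i j | bit b i j
  ... | true  | true  = refl
  ... | true  | false = refl
  ... | false | _     = refl
  arcS-orients b (inj₁ _) (inj₁ _) = refl
  arcS-orients b (inj₂ _) (inj₂ _) = refl

  orientation : Bits → OGraph n
  orientation b = record
    { arc = λ u v → arcS b (splitAt N u) (splitAt N v)
    ; loopless = λ u → arcS-loopless b (splitAt N u)
    ; noOpp = λ u v → arcS-noOpp b (splitAt N u) (splitAt N v) }

  orients : ∀ b → IsOrientation G (orientation b)
  orients b u v = arcS-orients b (splitAt N u) (splitAt N v)

  arc-nb : ∀ b i t → arc (orientation b) (left i) (right (nb i t)) ≡ lookup (lookup b i) t
  arc-nb b i t rewrite Fin.splitAt-↑ˡ N i (N + k) | Fin.splitAt-↑ʳ N (N + k) (nb i t) | edge-nb i t = bit-nb b i t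

  arc-nb′ : ∀ b i t → arc (orientation b) (right (nb i t)) (left i) ≡ not (lookup (lookup b i) t)
  arc-nb′ b i t rewrite Fin.splitAt-↑ˡ N i (N + k) | Fin.splitAt-↑ʳ N (N + k) (nb i t) | edge-nb i t = cong not (bit-nb b i t)

  Code : ℕ → Set
  Code m = Vec (Vec Bool m) m × Vec (Fin m × Bool) n

  decodeBit : ∀ {m} → Code m → Fin N → Fin (suc k) → Bool
  decodeBit (h , ψ) i t = let a , s = lookup ψ (left i) ; a′ , s′ = lookup ψ (right (nb i t)) in at h a a′ xor (s xor s′)

  -- If the pushed arc runs from left to right, the homomorphism provides the arc of `H`; if it runs
  -- from right to left, `noOpp` of `H` excludes that arc. Either way the bit is determined.
  hom-bit : ∀ b {m} (H : OGraph m) φ S → IsHom (pushArc (orientation b) S) H φ → ∀ i t →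
    lookup (lookup b i) t ≡ arc H (φ (left i)) (φ (right (nb i t))) xor (S (left i) xor S (right (nb i t)))
  hom-bit b H φ S hom i t = decide _ _ (S u) (S v) fwd bwd
    where
    u v : Fin n
    u = left i
    v = right (nb i t)
    x : Bool
    x = lookup (lookup b i) t
    fwd : (if S u xor S v then not x else x) ≡ true → arc H (φ u) (φ v) ≡ true
    fwd eq = hom u v (trans (cong₂ (λ p q → if S u xor S v then p else q) (arc-nb′ b i t) (arc-nb b i t)) eq)
    bwd : (if S v xor S u then x else not x) ≡ true → arc H (φ u) (φ v) ≡ false
    bwd eq = noOpp H (φ v) (φ u) (hom v u (trans (cong₂ (λ p q → if S v xor S u then p else q) (arc-nb b i t) (arc-nb′ b i t)) eq))
    decide : ∀ x y s s′ → ((if s xor s′ then not x else x) ≡ true → y ≡ true) →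
      ((if s′ xor s then x else not x) ≡ true → y ≡ false) → x ≡ y xor (s xor s′)
    decide true  y true  true  f g = sym (cong (_xor false) (f refl))
    decide true  y false false f g = sym (cong (_xor false) (f refl))
    decide true  y true  false f g = sym (cong (_xor true) (g refl))
    decide true  y false true  f g = sym (cong (_xor true) (g refl))
    decide false y true  true  f g = sym (cong (_xor false) (g refl))
    decide false y false false f g = sym (cong (_xor false) (g refl))
    decide false y true  false f g = sym (cong (_xor true) (f refl))
    decide false y false true  f g = sym (cong (_xor true) (f refl))

  encode : ∀ {m} → OGraph m → (Fin n → Fin m) → (Fin n → Bool) → Code m
  encode H φ S = tabulate (λ a → tabulate (arc H a)) , tabulate (λ u → φ u , S u)

  decode-encode : ∀ {m} (H : OGraph m) φ S i t →
    decodeBit (encode H φ S) i t ≡ arc H (φ (left i)) (φ (right (nb i t))) xor (S (left i) xor S (right (nb i t)))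
  decode-encode H φ S i t
    rewrite lookup∘tabulate (λ u → φ u , S u) (left i) | lookup∘tabulate (λ u → φ u , S u) (right (nb i t))
    = cong (_xor (S (left i) xor S (right (nb i t))))
        (trans (cong (λ v → lookup v (φ (right (nb i t)))) (lookup∘tabulate (λ a → tabulate (arc H a)) (φ (left i))))
          (lookup∘tabulate (arc H (φ (left i))) (φ (right (nb i t)))))

  -- The indicator of equality as a product over entries, so that its sum over all bit strings
  -- factorises: each code decodes to exactly one string.
  agree : (Fin N → Fin (suc k) → Bool) → Bits → ℕ
  agree f b = ∏ (λ i → ∏ (λ t → ind (not (f i t xor lookup (lookup b i) t))))

  ∏-one : ∀ {n} (f : Fin n → ℕ) → (∀ i → f i ≡ 1) → ∏ f ≡ 1
  ∏-one {zero}  f one = refl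
  ∏-one {suc n} f one = cong₂ _*_ (one zero) (∏-one (f ∘ suc) (one ∘ suc))

  agree-self : ∀ f b → (∀ i t → lookup (lookup b i) t ≡ f i t) → agree f b ≡ 1
  agree-self f b eq = ∏-one _ λ i → ∏-one _ λ t → cong (ind ∘ not) (trans (cong (f i t xor_) (eq i t)) (Bool.xor-same (f i t)))

  allBits : List Bits
  allBits = vecs N (vecs (suc k) bools)

  ∑-agree : ∀ f → ∑ allBits (agree f) ≡ 1
  ∑-agree f = trans (∑-vecs-∏ (vecs (suc k) bools) (λ i v → ∏ (λ t → ind (not (f i t xor lookup v t)))))
    (∏-one _ λ i → trans (∑-vecs-∏ bools (λ t y → ind (not (f i t xor y)))) (∏-one _ λ t → one (f i t)))
    where
    one : ∀ x → ∑ bools (λ y → ind (not (x xor y))) ≡ 1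
    one true  = refl
    one false = refl

  codes : ∀ m → List (Code m)
  codes m = cartesianProduct (vecs m (vecs m bools)) (vecs n (cartesianProduct (allFin m) bools))

  ∈-codes : ∀ {m} (x : Code m) → x ∈ codes m
  ∈-codes (h , ψ) = ∈-cartesianProduct⁺ (∈-vecs (∈-vecs ∈-bools) h) (∈-vecs (λ { (a , s) → ∈-cartesianProduct⁺ (∈-allFin a) (∈-bools s) }) ψ)

  length-codes : ∀ m → length (codes m) ≡ (2 ^ m) ^ m * (m * 2) ^ n
  length-codes m = trans (length-product _,_ (vecs m (vecs m bools)) _) (cong₂ _*_
    (trans (length-vecs m (vecs m bools)) (cong (_^ m) (length-vecs m bools)))
    (trans (length-vecs n _) (cong (_^ n) (trans (length-product _,_ (allFin m) bools) (cong (_* 2) (length-allFin m))))))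

  -- Since m ≤ m², at most `K` sizes satisfy m² < `K`. Each has at most `C` codes, and each code
  -- accounts for one orientation, so `lt` leaves an orientation without a code.
  module Bound (K C : ℕ) (le : ∀ m → m * m < K → length (codes m) ≤ C) (lt : K * C < (2 ^ suc k) ^ N) where

    sizes : List ℕ
    sizes = filter (λ m → m * m ℕ.<? K) (upTo K)

    hits : Bits → ℕ
    hits b = ∑ sizes (λ m → ∑ (codes m) (λ x → agree (decodeBit x) b))

    few-hits : ∑ allBits hits < length allBits
    few-hits = begin-strict
      ∑ allBits hits
        ≡⟨ ∑-swap allBits sizes _ ⟩
      ∑ sizes (λ m → ∑ allBits (λ b → ∑ (codes m) (λ x → agree (decodeBit x) b)))
        ≡⟨ ∑-cong sizes (λ m → trans (∑-swap allBits (codes m) _)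
             (trans (∑-cong (codes m) (λ x → ∑-agree (decodeBit x))) (sym (length≡∑ (codes m))))) ⟩
      ∑ sizes (λ m → length (codes m))
        ≤⟨ ∑-mono-∈ sizes (λ m m∈ → le m (proj₂ (∈-filter⁻ (λ m → m * m ℕ.<? K) {xs = upTo K} m∈))) ⟩
      ∑ sizes (λ _ → C)
        ≡⟨ ∑-const sizes C ⟩
      length sizes * C
        ≤⟨ *-monoˡ-≤ C (≤-trans (length-filter (λ m → m * m ℕ.<? K) (upTo K)) (≤-reflexive (length-upTo K))) ⟩
      K * C
        <⟨ lt ⟩
      (2 ^ suc k) ^ N
        ≡⟨ sym (trans (length-vecs N (vecs (suc k) bools)) (cong (_^ N) (length-vecs (suc k) bools))) ⟩
      length allBits ∎
      where open ≤-Reasoning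

    lower : Σ Bits λ b → ∀ m (H : OGraph m) φ → PushHom (orientation b) H φ → K ≤ m * m
    lower with ∑<length⇒∃0 allBits hits few-hits
    ... | b , none = b , λ m H φ (S , hom) → ≮⇒≥ λ m²<K →
      contradict m H φ S hom (∈-filter⁺ (λ m → m * m ℕ.<? K) (∈-upTo⁺ (≤-<-trans (m≤m*m m) m²<K)) m²<K)
      where
      contradict : ∀ m (H : OGraph m) φ S → IsHom (pushArc (orientation b) S) H φ → m ∈ sizes → ⊥
      contradict m H φ S hom m∈ = 1+n≢0 (trans (sym self)
        (∑≡0⇒≡0 (codes m) (λ x → agree (decodeBit x) b)
          (∑≡0⇒≡0 sizes (λ m → ∑ (codes m) (λ x → agree (decodeBit x) b)) none m∈) (∈-codes (encode H φ S))))
        where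
        self : agree (decodeBit (encode H φ S)) b ≡ 1
        self = agree-self _ b λ i t → trans (hom-bit b H φ S hom i t) (sym (decode-encode H φ S i t))

-- Assembling the two bounds

codes-bound : ∀ {x N k m} → m * m < suc x →
  (2 ^ m) ^ m * (m * 2) ^ (N + (N + k)) ≤ 2 ^ suc x * (4 ^ N * x ^ N * (suc x * 2) ^ k)
codes-bound {x} {N} {k} {m} m²<K = *-mono-≤
  (≤-trans (≤-reflexive (^-*-assoc 2 m m)) (^-monoʳ-≤ 2 (<⇒≤ m²<K)))
  (begin
    (m * 2) ^ (N + (N + k))               ≡⟨ trans (^-distribˡ-+-* (m * 2) N (N + k)) (cong ((m * 2) ^ N *_) (^-distribˡ-+-* (m * 2) N k)) ⟩
    (m * 2) ^ N * ((m * 2) ^ N * (m * 2) ^ k) ≡⟨ sym (*-assoc ((m * 2) ^ N) _ _) ⟩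
    (m * 2) ^ N * (m * 2) ^ N * (m * 2) ^ k ≡⟨ cong (_* (m * 2) ^ k) (sym (^-distribʳ-* (m * 2) (m * 2) N)) ⟩
    (m * 2 * (m * 2)) ^ N * (m * 2) ^ k   ≡⟨ cong (λ z → z ^ N * (m * 2) ^ k) (solve 1 (λ m → m :* con 2 :* (m :* con 2) := con 4 :* (m :* m)) refl m) ⟩
    -- Integrality turns m² < `suc x` into m² ≤ `x`. The ratio of `suc x` to `x`, raised to the
    -- power N, later outweighs all factors that do not depend on N.
    (4 * (m * m)) ^ N * (m * 2) ^ k       ≤⟨ *-mono-≤ (^-monoˡ-≤ N (*-monoʳ-≤ 4 (s≤s⁻¹ m²<K))) (^-monoˡ-≤ k (*-monoˡ-≤ 2 m≤K)) ⟩
    (4 * x) ^ N * (suc x * 2) ^ k         ≡⟨ cong (_* (suc x * 2) ^ k) (^-distribʳ-* 4 x N) ⟩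
    4 ^ N * x ^ N * (suc x * 2) ^ k       ∎)
  where
  open ≤-Reasoning
  m≤K : m ≤ suc x
  m≤K = ≤-trans (m≤m*m m) (<⇒≤ m²<K)

-- With Δ = 2 + d, comparing m² with 2^d expresses m ≥ 2^(Δ/2 - 1) without a half-integral exponent.
lower-bound : ∀ d → 1 ≤ d →
  Σ ℕ λ n → Σ (Graph n) λ G → Connected G × MaxDegree G (2 + d) ×
    Σ (OGraph n) λ D → IsOrientation G D ×
      (∀ m (H : OGraph m) φ → PushHom D H φ → 2 ^ d ≤ m * m)
lower-bound d 1≤d = n , G , connected , maxDegree , orientation (proj₁ lower) , orients (proj₁ lower)
  , λ m H φ hom → subst (_≤ m * m) K≡ (proj₂ lower m H φ hom)
  where
  x k : ℕ
  x = pred (2 ^ d)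
  k = suc d
  K≡ : suc x ≡ 2 ^ d
  K≡ = suc-pred (2 ^ d) {{m^n≢0 2 d}}
  x≢0 : NonZero x
  x≢0 = >-nonZero (s≤s⁻¹ (≤-trans (^-monoʳ-≤ 2 1≤d) (≤-reflexive (sym K≡))))
  C N : ℕ
  C = suc x * (2 ^ suc x * (suc x * 2) ^ k)
  -- `C` collects the factors free of N; this `N` makes the N-th power of `suc x` at least 2^C times
  -- that of `x`, and C < 2^C.
  N = suc x * C
  N≢0 : NonZero N
  N≢0 = m*n≢0 (suc x) C {{nonZero}} {{m*n≢0 (suc x) _ {{nonZero}}
    {{m*n≢0 (2 ^ suc x) _ {{m^n≢0 2 (suc x)}} {{m^n≢0 (suc x * 2) k}}}}}}
  open Band k N {{nonZero}} {{N≢0}}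
  count< : suc x * (2 ^ suc x * (4 ^ N * x ^ N * (suc x * 2) ^ k)) < (2 ^ suc k) ^ N
  count< = begin-strict
    suc x * (2 ^ suc x * (4 ^ N * x ^ N * (suc x * 2) ^ k))
      ≡⟨ solve 5 (λ a b c d e → a :* (b :* (c :* d :* e)) := c :* (a :* (b :* e) :* d)) refl (suc x) (2 ^ suc x) (4 ^ N) (x ^ N) ((suc x * 2) ^ k) ⟩
    4 ^ N * (C * x ^ N)
      <⟨ *-monoʳ-< (4 ^ N) {{m^n≢0 4 N}} (*x^< x {{x≢0}} C C (n<2^n C)) ⟩
    4 ^ N * suc x ^ N
      ≡⟨ sym (^-distribʳ-* 4 (suc x) N) ⟩
    (4 * suc x) ^ N
      ≡⟨ cong (_^ N) (trans (cong (4 *_) K≡) (*-assoc 2 2 (2 ^ d))) ⟩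
    (2 ^ suc k) ^ N ∎
    where open ≤-Reasoning
  open Bound (suc x) _ (λ m m²<K → ≤-trans (≤-reflexive (length-codes m)) (codes-bound {x} {N} {k} {m} m²<K)) count<

upper-bound : ∀ q → 25 ≤ q → ∀ n (G : Graph n) → Connected G → MaxDegree G (4 + q) →
  ∀ (D : OGraph n) → IsOrientation G D → PushColourable D (blocks q * 2 ^ (3 + q) + 2)
upper-bound q 25≤q n G conn (deg , r , _) D orient =
  let h , ext = tournament q 25≤q
      m , m≤ , H = Colour.Target.colourable {D = D} orient small k<c deg (beats h) (beats-flip h) (quotient (2 ^ (3 + q))) ext conn r
  -- `colourable` gives c + 1 colours: c from the tournament and one for the root.
  in m , ≤-trans m≤ (≤-trans (≤-reflexive (+-comm 1 _)) (+-monoʳ-≤ _ (s≤s z≤n))) , H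
  where
  small : 4 + q ≤ 2 ^ (2 + q)
  small = ≤-trans (≤-trans (m≤m+n (4 + q) q) (≤-reflexive (solve 1 (λ q → con 4 :+ q :+ q := con 2 :* (con 2 :+ q)) refl q)))
    (*-monoʳ-≤ 2 (n<2^n (1 + q)))
  k<c : 3 + q < blocks q * 2 ^ (3 + q)
  k<c = ≤-trans (n<2^n (3 + q)) (m≤n*m (2 ^ (3 + q)) (blocks q))

theorem2 : (Δ : ℕ) → 29 ≤ Δ →
    (Σ ℕ λ n → Σ (Graph n) λ G → Connected G × MaxDegree G Δ ×
    Σ (OGraph n) λ D → IsOrientation G D ×
    (∀ m (H : OGraph m) (φ : _) → PushHom D H φ → 2 ^ (Δ ∸ 2) ≤ m * m))
    ×
    (∀ n (G : Graph n) → Connected G → MaxDegree G Δ →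
    ∀ (D : OGraph n) → IsOrientation G D →
    PushColourable D ((Δ ∸ 3) * (Δ ∸ 1) * 2 ^ (Δ ∸ 1) + 2))
theorem2 (suc (suc (suc (suc q)))) (s≤s (s≤s (s≤s (s≤s 25≤q)))) =
  lower-bound (2 + q) (s≤s z≤n) , upper-bound q 25≤q
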